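{- Let $G$ be an $n$-vertex connected graph with minimum degree $\delta$ and let $G^c$ be the complement of $G$. If $q_1(G^c)<2\delta$, then $G$ has a fractional perfect matching.
   Context: Graphs are simple and undirected. For a graph $G$, $A(G)$ is its adjacency matrix, $D(G)$ the diagonal matrix of vertex degrees, $Q(G)=D(G)+A(G)$ its signless Laplacian, and $q_1(G)$ the largest eigenvalue of $Q(G)$. The complement $G^c$ has vertex set $V(G)$ and its edges are the pairs of distinct nonadjacent vertices of $G$. A fractional matching of $G$ is a function $f:E(G)\to[0,1]$ such that $\sum_{e\in\Gamma(v)}f(e)\le 1$ for each $v\in V(G)$, where $\Gamma(v)$ is the set of edges incident to $v$. A fractional perfect matching of an $n$-vertex graph $G$ is a fractional matching $f$ with $\sum_{e\in E(G)}f(e)=\frac{n}{2}$. -}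

module Defs where

open import Data.Bool using (Bool; false; not; _∧_; if_then_else_; T; T?)
open import Data.Fin as Fin using (Fin)
import Data.Fin.Properties as Fin
open import Data.Integer using (+_)
open import Data.List using (List; foldr; map; mapMaybe; filter; length; allFin; cartesianProduct)
open import Data.Maybe as Maybe using (Maybe)
open import Data.Nat as ℕ using (ℕ)
import Data.Nat.Properties as ℕ
open import Data.Product using (Σ-syntax; ∃-syntax; _×_; _,_; proj₁; proj₂)
open import Data.Rational as ℚ using (ℚ; 0ℚ; 1ℚ; ½; ∣_∣; 1/_; Positive; positive; nonNegative)
import Data.Rational.Properties as ℚ
open import Data.Rational.Solver using (module +-*-Solver)
open import Data.Sum using (_⊎_)
open import Relation.Binary.Construct.Closure.ReflexiveTransitive using (Star)
open import Relation.Binary.PropositionalEquality using (_≡_; refl; sym; trans; cong; cong₂; subst)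
open import Relation.Nullary using (¬_; Dec; yes; no)
open import Relation.Nullary.Decidable using (⌊_⌋; _×-dec_; _⊎-dec_; dec⇒maybe; dec-true; dec-false; isYes≗does)

-- A real number is a Cauchy sequence of rationals; equality of reals is the
-- setoid equality _≃_ below, not _≡_.
IsCauchy : (ℕ → ℚ) → Set
IsCauchy x = ∀ ε → 0ℚ ℚ.< ε → ∃[ N ] (∀ m n → N ℕ.≤ m → N ℕ.≤ n → ∣ x m ℚ.- x n ∣ ℚ.≤ ε)

record ℝ : Set where
  constructor mkℝ
  field
    seq    : ℕ → ℚ
    cauchy : IsCauchy seq

open ℝ public

infix 4 _≃_ _≤_ _<_

record _≃_ (x y : ℝ) : Set where
  constructor mk≃
  field
    close : ∀ ε → 0ℚ ℚ.< ε → ∃[ N ] (∀ n → N ℕ.≤ n → ∣ seq x n ℚ.- seq y n ∣ ℚ.≤ ε)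

record _≤_ (x y : ℝ) : Set where
  constructor mk≤
  field
    almost-≤ : ∀ ε → 0ℚ ℚ.< ε → ∃[ N ] (∀ n → N ℕ.≤ n → seq x n ℚ.≤ seq y n ℚ.+ ε)

record _<_ (x y : ℝ) : Set where
  constructor mk<
  field
    gap      : ℚ
    gap>0    : 0ℚ ℚ.< gap
    cutoff   : ℕ
    separate : ∀ n → cutoff ℕ.≤ n → seq x n ℚ.+ gap ℚ.≤ seq y n

open _≃_ public
open _≤_ public
open _<_ public

const-cauchy : ∀ q → IsCauchy (λ _ → q)
const-cauchy q ε 0<ε = 0 , λ _ _ _ _ →
  subst (ℚ._≤ ε) (sym (cong ∣_∣ (ℚ.+-inverseʳ q))) (ℚ.<⇒≤ 0<ε)

fromℚ : ℚ → ℝ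
fromℚ q = mkℝ (λ _ → q) (const-cauchy q)

fromℕ : ℕ → ℝ
fromℕ n = fromℚ (+ n ℚ./ 1)

0ℝ 1ℝ : ℝ
0ℝ = fromℚ 0ℚ
1ℝ = fromℚ 1ℚ

+-cauchy : ∀ x y → IsCauchy x → IsCauchy y → IsCauchy (λ n → x n ℚ.+ y n)
+-cauchy x y cx cy ε 0<ε = proj₁ X ℕ.⊔ proj₁ Y , λ m n N≤m N≤n → begin
  ∣ (x m ℚ.+ y m) ℚ.- (x n ℚ.+ y n) ∣    ≡⟨ cong ∣_∣ (rearrange (x m) (y m) (x n) (y n)) ⟩
  ∣ (x m ℚ.- x n) ℚ.+ (y m ℚ.- y n) ∣    ≤⟨ ℚ.∣p+q∣≤∣p∣+∣q∣ (x m ℚ.- x n) (y m ℚ.- y n) ⟩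
  ∣ x m ℚ.- x n ∣ ℚ.+ ∣ y m ℚ.- y n ∣    ≤⟨ ℚ.+-mono-≤
      (proj₂ X m n (ℕ.≤-trans (ℕ.m≤m⊔n _ _) N≤m) (ℕ.≤-trans (ℕ.m≤m⊔n _ _) N≤n))
      (proj₂ Y m n (ℕ.≤-trans (ℕ.m≤n⊔m (proj₁ X) _) N≤m) (ℕ.≤-trans (ℕ.m≤n⊔m (proj₁ X) _) N≤n)) ⟩
  ½ ℚ.* ε ℚ.+ ½ ℚ.* ε                    ≡⟨ sym (ℚ.*-distribʳ-+ ε ½ ½) ⟩
  1ℚ ℚ.* ε                               ≡⟨ ℚ.*-identityˡ ε ⟩
  ε                                      ∎
  where
  open ℚ.≤-Reasoning
  open +-*-Solver
  0<ε/2 : 0ℚ ℚ.< ½ ℚ.* ε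
  0<ε/2 = ℚ.positive⁻¹ (½ ℚ.* ε) {{ℚ.pos*pos⇒pos ½ ε {{positive 0<ε}}}}
  X = cx (½ ℚ.* ε) 0<ε/2
  Y = cy (½ ℚ.* ε) 0<ε/2
  rearrange : ∀ a b c d → (a ℚ.+ b) ℚ.- (c ℚ.+ d) ≡ (a ℚ.- c) ℚ.+ (b ℚ.- d)
  rearrange = solve 4 (λ a b c d → (a :+ b) :- (c :+ d) := (a :- c) :+ (b :- d)) refl

cauchy⇒bounded : ∀ x → IsCauchy x → ∃[ B ] (Positive B × ∃[ N ] (∀ n → N ℕ.≤ n → ∣ x n ∣ ℚ.≤ B))
cauchy⇒bounded x cx = 1ℚ ℚ.+ ∣ x N ∣ , ℚ.pos+nonNeg⇒pos 1ℚ ∣ x N ∣ {{ℚ.∣-∣-nonNeg (x N)}} , N , λ n N≤n → begin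
  ∣ x n ∣                       ≡⟨ cong ∣_∣ (split (x n) (x N)) ⟩
  ∣ (x n ℚ.- x N) ℚ.+ x N ∣     ≤⟨ ℚ.∣p+q∣≤∣p∣+∣q∣ (x n ℚ.- x N) (x N) ⟩
  ∣ x n ℚ.- x N ∣ ℚ.+ ∣ x N ∣   ≤⟨ ℚ.+-monoˡ-≤ ∣ x N ∣ (proj₂ X n N N≤n ℕ.≤-refl) ⟩
  1ℚ ℚ.+ ∣ x N ∣                ∎
  where
  open ℚ.≤-Reasoning
  open +-*-Solver
  X = cx 1ℚ (ℚ.positive⁻¹ 1ℚ)
  N = proj₁ X
  split : ∀ a b → a ≡ (a ℚ.- b) ℚ.+ b
  split = solve 2 (λ a b → a := (a :- b) :+ b) refl

divide : ∀ ε → 0ℚ ℚ.< ε → ∀ s → Positive s → ∃[ η ] (0ℚ ℚ.< η × s ℚ.* η ≡ ε)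
divide ε 0<ε s s>0 = 1/s ℚ.* ε , 0<η , trans (sym (ℚ.*-assoc s 1/s ε))
  (trans (cong (ℚ._* ε) (ℚ.*-inverseʳ s {{s≢0}})) (ℚ.*-identityˡ ε))
  where
  s≢0 = ℚ.pos⇒nonZero s {{s>0}}
  1/s : ℚ
  1/s = (1/ s) {{s≢0}}
  0<η : 0ℚ ℚ.< 1/s ℚ.* ε
  0<η = ℚ.positive⁻¹ (1/s ℚ.* ε) {{ℚ.pos*pos⇒pos 1/s {{ℚ.1/pos⇒pos s {{s>0}}}} ε {{positive 0<ε}}}}

∣p*q∣-mono : ∀ p q {b η} → 0ℚ ℚ.< η → ∣ p ∣ ℚ.≤ b → ∣ q ∣ ℚ.≤ η → ∣ p ℚ.* q ∣ ℚ.≤ b ℚ.* η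
∣p*q∣-mono p q {b} {η} 0<η p≤b q≤η = begin
  ∣ p ℚ.* q ∣          ≡⟨ ℚ.∣p*q∣≡∣p∣*∣q∣ p q ⟩
  ∣ p ∣ ℚ.* ∣ q ∣      ≤⟨ ℚ.*-monoˡ-≤-nonNeg ∣ p ∣ {{ℚ.∣-∣-nonNeg p}} q≤η ⟩
  ∣ p ∣ ℚ.* η          ≤⟨ ℚ.*-monoʳ-≤-nonNeg η {{nonNegative (ℚ.<⇒≤ 0<η)}} p≤b ⟩
  b ℚ.* η              ∎
  where open ℚ.≤-Reasoning

∣ab-cd∣≤ : ∀ a b c d {B C η} → 0ℚ ℚ.< η → ∣ a ∣ ℚ.≤ B → ∣ d ∣ ℚ.≤ C →
           ∣ a ℚ.- c ∣ ℚ.≤ η → ∣ b ℚ.- d ∣ ℚ.≤ η → ∣ a ℚ.* b ℚ.- c ℚ.* d ∣ ℚ.≤ (B ℚ.+ C) ℚ.* η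
∣ab-cd∣≤ a b c d {B} {C} {η} 0<η a≤B d≤C a-c≤η b-d≤η = begin
  ∣ a ℚ.* b ℚ.- c ℚ.* d ∣                            ≡⟨ cong ∣_∣ (rearrange a b c d) ⟩
  ∣ a ℚ.* (b ℚ.- d) ℚ.+ d ℚ.* (a ℚ.- c) ∣            ≤⟨ ℚ.∣p+q∣≤∣p∣+∣q∣ (a ℚ.* (b ℚ.- d)) (d ℚ.* (a ℚ.- c)) ⟩
  ∣ a ℚ.* (b ℚ.- d) ∣ ℚ.+ ∣ d ℚ.* (a ℚ.- c) ∣        ≤⟨ ℚ.+-mono-≤ (∣p*q∣-mono a (b ℚ.- d) 0<η a≤B b-d≤η)
                                                                   (∣p*q∣-mono d (a ℚ.- c) 0<η d≤C a-c≤η) ⟩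
  B ℚ.* η ℚ.+ C ℚ.* η                                ≡⟨ sym (ℚ.*-distribʳ-+ η B C) ⟩
  (B ℚ.+ C) ℚ.* η                                    ∎
  where
  open ℚ.≤-Reasoning
  open +-*-Solver
  rearrange : ∀ a b c d → a ℚ.* b ℚ.- c ℚ.* d ≡ a ℚ.* (b ℚ.- d) ℚ.+ d ℚ.* (a ℚ.- c)
  rearrange = solve 4 (λ a b c d → a :* b :- c :* d := a :* (b :- d) :+ d :* (a :- c)) refl

*-cauchy : ∀ x y → IsCauchy x → IsCauchy y → IsCauchy (λ n → x n ℚ.* y n)
*-cauchy x y cx cy ε 0<ε = choose-η (cauchy⇒bounded x cx) (cauchy⇒bounded y cy)
  where
  Goal : Set
  Goal = ∃[ N ] (∀ m n → N ℕ.≤ m → N ℕ.≤ n → ∣ x m ℚ.* y m ℚ.- x n ℚ.* y n ∣ ℚ.≤ ε)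

  Bound : (ℕ → ℚ) → ℚ → Set
  Bound z B = ∃[ N ] (∀ n → N ℕ.≤ n → ∣ z n ∣ ℚ.≤ B)

  Close : (ℕ → ℚ) → ℚ → Set
  Close z η = ∃[ N ] (∀ m n → N ℕ.≤ m → N ℕ.≤ n → ∣ z m ℚ.- z n ∣ ℚ.≤ η)

  combine : ∀ {B C η} → 0ℚ ℚ.< η → (B ℚ.+ C) ℚ.* η ≡ ε → Bound x B → Bound y C → Close x η → Close y η → Goal
  combine 0<η refl (K , x≤B) (L , y≤C) (M , x-close) (N , y-close) =
    (K ℕ.⊔ L) ℕ.⊔ (M ℕ.⊔ N) , λ m n ≤m ≤n →
      ∣ab-cd∣≤ (x m) (y m) (x n) (y n) 0<η
        (x≤B m (ℕ.≤-trans K≤ ≤m)) (y≤C n (ℕ.≤-trans L≤ ≤n))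
        (x-close m n (ℕ.≤-trans M≤ ≤m) (ℕ.≤-trans M≤ ≤n))
        (y-close m n (ℕ.≤-trans N≤ ≤m) (ℕ.≤-trans N≤ ≤n))
    where
    K≤ = ℕ.≤-trans (ℕ.m≤m⊔n K L) (ℕ.m≤m⊔n (K ℕ.⊔ L) (M ℕ.⊔ N))
    L≤ = ℕ.≤-trans (ℕ.m≤n⊔m K L) (ℕ.m≤m⊔n (K ℕ.⊔ L) (M ℕ.⊔ N))
    M≤ = ℕ.≤-trans (ℕ.m≤m⊔n M N) (ℕ.m≤n⊔m (K ℕ.⊔ L) (M ℕ.⊔ N))
    N≤ = ℕ.≤-trans (ℕ.m≤n⊔m M N) (ℕ.m≤n⊔m (K ℕ.⊔ L) (M ℕ.⊔ N))

  use-η : ∀ {B C} → Bound x B → Bound y C → ∃[ η ] (0ℚ ℚ.< η × (B ℚ.+ C) ℚ.* η ≡ ε) → Goal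
  use-η x≤B y≤C (η , 0<η , eq) = combine 0<η eq x≤B y≤C (cx η 0<η) (cy η 0<η)

  choose-η : ∃[ B ] (Positive B × Bound x B) → ∃[ C ] (Positive C × Bound y C) → Goal
  choose-η (B , B>0 , x≤B) (C , C>0 , y≤C) =
    use-η x≤B y≤C (divide ε 0<ε (B ℚ.+ C) (ℚ.pos+pos⇒pos B {{B>0}} C {{C>0}}))

infixl 6 _+_
infixl 7 _*_

_+_ : ℝ → ℝ → ℝ
x + y = mkℝ (λ n → seq x n ℚ.+ seq y n) (+-cauchy (seq x) (seq y) (cauchy x) (cauchy y))

_*_ : ℝ → ℝ → ℝ
x * y = mkℝ (λ n → seq x n ℚ.* seq y n) (*-cauchy (seq x) (seq y) (cauchy x) (cauchy y))

∑ : ∀ {A : Set} → List A → (A → ℝ) → ℝ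
∑ xs f = foldr _+_ 0ℝ (map f xs)

record Graph (n : ℕ) : Set where
  field
    adj     : Fin n → Fin n → Bool
    adj-sym : ∀ u v → adj u v ≡ adj v u
    no-loop : ∀ v → adj v v ≡ false

  Adj : Fin n → Fin n → Set
  Adj u v = T (adj u v)

open Graph public

complement : ∀ {n : ℕ} → Graph n → Graph n
complement G = record
  { adj     = λ u v → not ⌊ u Fin.≟ v ⌋ ∧ not (adj G u v)
  ; adj-sym = λ u v → cong₂ (λ a b → not a ∧ not b) (≟-sym u v) (adj-sym G u v)
  ; no-loop = λ v → cong (λ a → not a ∧ not (adj G v v))
                         (trans (isYes≗does (v Fin.≟ v)) (dec-true (v Fin.≟ v) refl))
  }
  where
  ≟-sym : ∀ {n : ℕ} (u v : Fin n) → ⌊ u Fin.≟ v ⌋ ≡ ⌊ v Fin.≟ u ⌋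
  ≟-sym u v with u Fin.≟ v
  ... | yes refl = sym (trans (isYes≗does (u Fin.≟ u)) (dec-true (u Fin.≟ u) refl))
  ... | no u≢v   = sym (trans (isYes≗does (v Fin.≟ u)) (dec-false (v Fin.≟ u) (λ v≡u → u≢v (sym v≡u))))

Connected : ∀ {n : ℕ} → Graph n → Set
Connected G = ∀ u v → Star (Adj G) u v

degree : ∀ {n : ℕ} → Graph n → Fin n → ℕ
degree {n} G v = length (filter (λ u → T? (adj G v u)) (allFin n))

-- Attainment of δ makes the vertex set nonempty.
IsMinDegree : ∀ {n : ℕ} → Graph n → ℕ → Set
IsMinDegree G δ = (∃[ v ] degree G v ≡ δ) × (∀ v → δ ℕ.≤ degree G v)

Matrix : ℕ → Set
Matrix n = Fin n → Fin n → ℝ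

IsEigenvalue : ∀ {n : ℕ} → Matrix n → ℝ → Set
IsEigenvalue {n} M μ = Σ[ x ∈ (Fin n → ℝ) ] (¬ (∀ i → x i ≃ 0ℝ) × (∀ i → ∑ (allFin n) (λ j → M i j * x j) ≃ μ * x i))

IsLargestEigenvalue : ∀ {n : ℕ} → Matrix n → ℝ → Set
IsLargestEigenvalue M q = IsEigenvalue M q × (∀ μ → IsEigenvalue M μ → μ ≤ q)

adjacencyMatrix : ∀ {n : ℕ} → Graph n → Matrix n
adjacencyMatrix G i j = if adj G i j then 1ℝ else 0ℝ

degreeMatrix : ∀ {n : ℕ} → Graph n → Matrix n
degreeMatrix G i j = if ⌊ i Fin.≟ j ⌋ then fromℕ (degree G i) else 0ℝ

signlessLaplacian : ∀ {n : ℕ} → Graph n → Matrix n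
signlessLaplacian G i j = degreeMatrix G i j + adjacencyMatrix G i j

Isq₁ : ∀ {n : ℕ} → Graph n → ℝ → Set
Isq₁ G q = IsLargestEigenvalue (signlessLaplacian G) q

-- The edge {u, v} is represented once, by its endpoints in increasing order.
record Edge {n : ℕ} (G : Graph n) : Set where
  constructor mkEdge
  field
    lo hi : Fin n
    lo<hi : lo Fin.< hi
    lo~hi : Adj G lo hi

open Edge public

toEdge : ∀ {n : ℕ} (G : Graph n) → Fin n × Fin n → Maybe (Edge G)
toEdge G (u , v) = Maybe.map (λ (u<v , u~v) → mkEdge u v u<v u~v)
                             (dec⇒maybe ((u Fin.<? v) ×-dec T? (adj G u v)))

edges : ∀ {n : ℕ} (G : Graph n) → List (Edge G)
edges {n} G = mapMaybe (toEdge G) (cartesianProduct (allFin n) (allFin n))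

incident? : ∀ {n : ℕ} {G : Graph n} (v : Fin n) (e : Edge G) → Dec (v ≡ lo e ⊎ v ≡ hi e)
incident? v e = (v Fin.≟ lo e) ⊎-dec (v Fin.≟ hi e)

Γ : ∀ {n : ℕ} (G : Graph n) → Fin n → List (Edge G)
Γ G v = filter (incident? v) (edges G)

IsFractionalMatching : ∀ {n : ℕ} (G : Graph n) → (Edge G → ℝ) → Set
IsFractionalMatching G f = (∀ e → 0ℝ ≤ f e × f e ≤ 1ℝ) × (∀ v → ∑ (Γ G v) f ≤ 1ℝ)

IsFractionalPerfectMatching : ∀ {n : ℕ} (G : Graph n) → (Edge G → ℝ) → Set
IsFractionalPerfectMatching {n} G f = IsFractionalMatching G f × ∑ (edges G) f ≃ fromℚ (+ n ℚ./ 2)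

HasFractionalPerfectMatching : ∀ {n : ℕ} → Graph n → Set
HasFractionalPerfectMatching G = Σ[ f ∈ (Edge G → ℝ) ] IsFractionalPerfectMatching G f

{-# OPTIONS --safe #-}
module Submission where

-- Hall's theorem for the relation "adjacent" on V × V gives either an injective σ with v ~ σ v,
-- and then f(uv) = ½[σ u = v] + ½[σ v = u] is a fractional perfect matching, or a set X with
-- |N(X)| < |X|.  In the second case I = X ∖ N(X) is independent and |I| > |N(I)| ≥ δ, so I is a
-- clique of Gᶜ whose indicator vector has Rayleigh quotient at least 2(|I| − 1) ≥ 2δ for Q(Gᶜ).
--
-- To contradict q₁ < 2δ constructively, an eigenvalue λ ≥ 2δ is produced.  Division-free symmetric
-- elimination decides over ℚ whether t − Q is positive definite, so bisection yields the supremum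
-- λ of the Rayleigh quotient as a Cauchy sequence.  The same elimination run on λ − Q over the
-- reals, where signs are known up to double negation, leaves only a kernel vector: a negative
-- vector contradicts the upper ends of the brackets, definiteness the lower ends.

-- `Isq₁` bounds only numbers that are already known to be eigenvalues, so a vector with a large
-- Rayleigh quotient says nothing about `q` until some eigenvalue above that quotient is exhibited.
-- This is why the supremum has to be built as a real number and a kernel vector extracted for it. A
-- double negation in front of that eigenvalue is harmless: it is used only in the branch that ends
-- by contradicting `q < 2δ`, while the matching comes from a decidable search over subsets and
-- edges.
--
-- Elimination multiplies pivots out instead of dividing by them, because a positive real pivot is a
-- sequence whose early terms may be zero and cannot be inverted term by term. Without division
-- every identity becomes a polynomial identity that holds at each index, so one argument serves
-- both for rational numbers and for Cauchy sequences, and only the sign predicates look at a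
-- sequence as a whole.

-- Rational arithmetic and finite sums.

module RationalLemmas where
  open import Data.Fin using (Fin; zero; suc; _≟_)
  import Data.Integer as ℤ
  open import Data.Integer using (+_)
  import Data.Integer.Properties as ℤ
  open import Data.Nat using (ℕ; zero; suc)
  import Data.Nat as ℕ
  import Data.Nat.Properties as ℕ
  open import Data.Product using (∃-syntax; _,_)
  open import Data.Rational hiding (_≟_)
  open import Data.Rational.Properties hiding (_≟_)
  open import Data.Rational.Solver using (module +-*-Solver)
  import Data.Rational.Unnormalised as ℚᵘ
  import Data.Rational.Unnormalised.Properties as ℚᵘ
  open import Algebra.Bundles using (CommutativeRing)
  open import Algebra.Properties.Semiring.Sum (CommutativeRing.semiring +-*-commutativeRing) public
    using (sum; sum-cong-≗; ∑-distrib-+; ∑-comm; *-distribˡ-sum; *-distribʳ-sum; sum-replicate-zero)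
  open import Data.Bool using (true; false; if_then_else_)
  open import Data.Sum using (inj₁; inj₂)
  open import Function using (_∘_)
  open import Relation.Binary.PropositionalEquality
  open import Relation.Nullary using (yes; no; does; contradiction)
  open +-*-Solver

  0≤+ : ∀ {p q} → 0ℚ ≤ p → 0ℚ ≤ q → 0ℚ ≤ p + q
  0≤+ = +-mono-≤

  0<+ : ∀ {p q} → 0ℚ < p → 0ℚ ≤ q → 0ℚ < p + q
  0<+ = +-mono-<-≤

  0≤* : ∀ {p q} → 0ℚ ≤ p → 0ℚ ≤ q → 0ℚ ≤ p * q
  0≤* {p} {q} 0≤p 0≤q =
    nonNegative⁻¹ (p * q) {{nonNeg*nonNeg⇒nonNeg p {{nonNegative 0≤p}} q {{nonNegative 0≤q}}}}

  0<* : ∀ {p q} → 0ℚ < p → 0ℚ < q → 0ℚ < p * q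
  0<* {p} {q} 0<p 0<q = positive⁻¹ (p * q) {{pos*pos⇒pos p {{positive 0<p}} q {{positive 0<q}}}}

  0≤p*p : ∀ p → 0ℚ ≤ p * p
  0≤p*p p with ≤-total 0ℚ p
  ... | inj₁ 0≤p = 0≤* 0≤p 0≤p
  ... | inj₂ p≤0 = subst (0ℚ ≤_) (solve 1 (λ p → :- p :* :- p := p :* p) refl p)
                     (0≤* (neg-antimono-≤ p≤0) (neg-antimono-≤ p≤0))

  p≤q⇒0≤q-p : ∀ {p q} → p ≤ q → 0ℚ ≤ q - p
  p≤q⇒0≤q-p {p} {q} p≤q = subst (_≤ q - p) (+-inverseʳ p) (+-monoˡ-≤ (- p) p≤q)

  0≤q-p⇒p≤q : ∀ {p q} → 0ℚ ≤ q - p → p ≤ q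
  0≤q-p⇒p≤q {p} {q} 0≤q-p = subst₂ _≤_ (+-identityˡ p)
    (solve 2 (λ p q → (q :- p) :+ p := q) refl p q) (+-monoˡ-≤ p 0≤q-p)

  p<q⇒0<q-p : ∀ {p q} → p < q → 0ℚ < q - p
  p<q⇒0<q-p {p} {q} p<q = subst (_< q - p) (+-inverseʳ p) (+-monoˡ-< (- p) p<q)

  p≤q⇒∣p∣≤ : ∀ {p q} → p ≤ q → - p ≤ q → ∣ p ∣ ≤ q
  p≤q⇒∣p∣≤ {p} {q} p≤q -p≤q with ∣p∣≡p∨∣p∣≡-p p
  ... | inj₁ eq = subst (_≤ q) (sym eq) p≤q
  ... | inj₂ eq = subst (_≤ q) (sym eq) -p≤q

  p≤∣p∣ : ∀ p → p ≤ ∣ p ∣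
  p≤∣p∣ p with ≤-total 0ℚ p
  ... | inj₁ 0≤p = ≤-reflexive (sym (0≤p⇒∣p∣≡p 0≤p))
  ... | inj₂ p≤0 = ≤-trans p≤0 (0≤∣p∣ p)

  -∣p∣≤p : ∀ p → - ∣ p ∣ ≤ p
  -∣p∣≤p p = subst (- ∣ p ∣ ≤_) (solve 1 (λ p → :- (:- p) := p) refl p)
    (neg-antimono-≤ (subst (- p ≤_) (∣-p∣≡∣p∣ p) (p≤∣p∣ (- p))))

  fromℚᵘ-homo-+ : ∀ p q → fromℚᵘ (p ℚᵘ.+ q) ≡ fromℚᵘ p + fromℚᵘ q
  fromℚᵘ-homo-+ p q = toℚᵘ-injective (ℚᵘ.≃-trans (toℚᵘ-fromℚᵘ (p ℚᵘ.+ q)) (ℚᵘ.≃-sym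
    (ℚᵘ.≃-trans (toℚᵘ-homo-+ (fromℚᵘ p) (fromℚᵘ q)) (ℚᵘ.+-cong (toℚᵘ-fromℚᵘ p) (toℚᵘ-fromℚᵘ q)))))

  -- Used with denominator 1 for the embedding `ι` of the naturals, and with denominator 2 for the
  -- total weight n/2 of the matching.
  /-suc : ∀ k d → + suc k / suc d ≡ + 1 / suc d + + k / suc d
  /-suc k d = trans
    (fromℚᵘ-cong {ℚᵘ.mkℚᵘ (+ suc k) d} {ℚᵘ.mkℚᵘ (+ 1) d ℚᵘ.+ ℚᵘ.mkℚᵘ (+ k) d} (ℚᵘ.*≡* eq))
    (fromℚᵘ-homo-+ (ℚᵘ.mkℚᵘ (+ 1) d) (ℚᵘ.mkℚᵘ (+ k) d))
    where
    D = + suc d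
    eq : + suc k ℤ.* (D ℤ.* D) ≡ (+ 1 ℤ.* D ℤ.+ + k ℤ.* D) ℤ.* D
    eq = trans (sym (ℤ.*-assoc (+ suc k) D D)) (cong (ℤ._* D) (ℤ.*-distribʳ-+ D (+ 1) (+ k)))

  ι : ℕ → ℚ
  ι k = + k / 1

  ι-suc : ∀ k → ι (suc k) ≡ 1ℚ + ι k
  ι-suc k = /-suc k 0

  0≤ι : ∀ k → 0ℚ ≤ ι k
  0≤ι zero    = ≤-refl
  0≤ι (suc k) = subst (0ℚ ≤_) (sym (ι-suc k)) (0≤+ (nonNegative⁻¹ 1ℚ) (0≤ι k))

  ι-+ : ∀ k l → ι (k ℕ.+ l) ≡ ι k + ι l
  ι-+ zero    l = sym (+-identityˡ (ι l))
  ι-+ (suc k) l = trans (ι-suc (k ℕ.+ l)) (trans (cong (_+_ 1ℚ) (ι-+ k l))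
    (trans (sym (+-assoc 1ℚ (ι k) (ι l))) (cong (_+ ι l) (sym (ι-suc k)))))

  ι-mono : ∀ {k l} → k ℕ.≤ l → ι k ≤ ι l
  ι-mono {k} {l} k≤l = subst₂ _≤_ (+-identityʳ (ι k))
    (trans (sym (ι-+ k (l ℕ.∸ k))) (cong ι (ℕ.m+[n∸m]≡n k≤l))) (+-monoʳ-≤ (ι k) (0≤ι (l ℕ.∸ k)))

  -- The denominator is at least 1, so the absolute value of the numerator already bounds the
  -- fraction.
  ≤ι : ∀ p → ∃[ k ] p ≤ ι k
  ≤ι p@record{} = ℤ.∣ ↥ p ∣ , toℚᵘ-cancel-≤ (ℚᵘ.≤-respʳ-≃ (ℚᵘ.≃-sym (toℚᵘ-fromℚᵘ K)) (ℚᵘ.*≤* (begin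
    ↥ p ℤ.* + 1                     ≡⟨ ℤ.*-identityʳ (↥ p) ⟩
    ↥ p                             ≤⟨ i≤∣i∣ (↥ p) ⟩
    + ℤ.∣ ↥ p ∣                     ≤⟨ ℤ.+≤+ (ℕ.m≤m*n ℤ.∣ ↥ p ∣ (suc (ℚ.denominator-1 p))) ⟩
    + (ℤ.∣ ↥ p ∣ ℕ.* suc (ℚ.denominator-1 p))  ≡⟨ ℤ.pos-* ℤ.∣ ↥ p ∣ (suc (ℚ.denominator-1 p)) ⟩
    + ℤ.∣ ↥ p ∣ ℤ.* ↧ p             ∎)))
    where
    open ℤ.≤-Reasoning
    K = ℚᵘ.mkℚᵘ (+ ℤ.∣ ↥ p ∣) 0
    i≤∣i∣ : ∀ i → i ℤ.≤ + ℤ.∣ i ∣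
    i≤∣i∣ (+ _)      = ℤ.≤-refl
    i≤∣i∣ ℤ.-[1+ _ ] = ℤ.-≤+

  sum-mono : ∀ {n} {f g : Fin n → ℚ} → (∀ i → f i ≤ g i) → sum f ≤ sum g
  sum-mono {zero}  f≤g = ≤-refl
  sum-mono {suc n} f≤g = +-mono-≤ (f≤g zero) (sum-mono (f≤g ∘ suc))

  sum-nonNeg : ∀ {n} {f : Fin n → ℚ} → (∀ i → 0ℚ ≤ f i) → 0ℚ ≤ sum f
  sum-nonNeg {zero}  0≤f = ≤-refl
  sum-nonNeg {suc n} 0≤f = 0≤+ (0≤f zero) (sum-nonNeg (0≤f ∘ suc))

  sum-pos : ∀ {n} {f : Fin n → ℚ} → (∀ i → 0ℚ ≤ f i) → ∀ k → 0ℚ < f k → 0ℚ < sum f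
  sum-pos 0≤f zero    0<fk = 0<+ 0<fk (sum-nonNeg (0≤f ∘ suc))
  sum-pos 0≤f (suc k) 0<fk = +-mono-≤-< (0≤f zero) (sum-pos (0≤f ∘ suc) k 0<fk)

  sum-zero : ∀ {n} {f : Fin n → ℚ} → (∀ i → f i ≡ 0ℚ) → sum f ≡ 0ℚ
  sum-zero {n} f≡0 = trans (sum-cong-≗ f≡0) (sum-replicate-zero n)

  sum-neg : ∀ {n} (f : Fin n → ℚ) → sum (λ i → - f i) ≡ - sum f
  sum-neg {zero}  f = refl
  sum-neg {suc n} f = trans (cong (_+_ (- f zero)) (sum-neg (f ∘ suc))) (sym (neg-distrib-+ (f zero) _))

  -- Kronecker's delta. Branching on `does` makes `δ (suc i) (suc j)` reduce to `δ i j`, which the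
  -- inductions below rely on.
  δ : ∀ {n} → Fin n → Fin n → ℚ
  δ i j = if does (i ≟ j) then 1ℚ else 0ℚ

  sum-δˡ : ∀ {n} (f : Fin n → ℚ) i → sum (λ j → δ i j * f j) ≡ f i
  sum-δˡ {suc n} f zero = trans (cong₂ _+_ (*-identityˡ (f zero)) (sum-zero (λ j → *-zeroˡ (f (suc j)))))
    (+-identityʳ (f zero))
  sum-δˡ {suc n} f (suc i) = trans (cong₂ _+_ (*-zeroˡ (f zero)) (sum-δˡ (f ∘ suc) i)) (+-identityˡ _)

  δ-sym : ∀ {n} (i j : Fin n) → δ i j ≡ δ j i
  δ-sym zero    zero    = refl
  δ-sym zero    (suc j) = refl
  δ-sym (suc i) zero    = refl
  δ-sym (suc i) (suc j) = δ-sym i j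

  δ-refl : ∀ {n} (i : Fin n) → δ i i ≡ 1ℚ
  δ-refl zero    = refl
  δ-refl (suc i) = δ-refl i

  0≤δ : ∀ {n} (u v : Fin n) → 0ℚ ≤ δ u v
  0≤δ u v with does (u ≟ v)
  ... | true  = nonNegative⁻¹ 1ℚ
  ... | false = ≤-refl

  δ≤1 : ∀ {n} (u v : Fin n) → δ u v ≤ 1ℚ
  δ≤1 u v with does (u ≟ v)
  ... | true  = ≤-refl
  ... | false = nonNegative⁻¹ 1ℚ

  δ-≢ : ∀ {n} {u v : Fin n} → u ≢ v → δ u v ≡ 0ℚ
  δ-≢ {u = u} {v} u≢v with u ≟ v
  ... | yes u≡v = contradiction u≡v u≢v
  ... | no _    = refl

  sum-δ : ∀ {n} (u : Fin n) → sum (δ u) ≡ 1ℚ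
  sum-δ u = trans (sum-cong-≗ (λ v → sym (*-identityʳ (δ u v)))) (sum-δˡ (λ _ → 1ℚ) u)

-- Hall's theorem for a relation given by a family of subsets.

module HallsTheorem where
  open import Data.Bool using (true; false)
  open import Data.Fin using (Fin; zero; suc; _≟_)
  open import Data.Fin.Properties using (any?)
  open import Data.Fin.Subset
  open import Data.Fin.Subset.Properties
  open import Data.Nat using (ℕ; suc; _+_; _≤_; _<_; _<?_; z≤n; s≤s)
  open import Data.Nat.Induction using (<-wellFounded)
  open import Data.Nat.Properties hiding (_≟_)
  open import Data.Product using (∃-syntax; _×_; _,_; proj₁; proj₂)
  open import Data.Sum using (_⊎_; inj₁; inj₂; [_,_]′)
  open import Data.Vec using ([]; _∷_; tabulate)
  open import Data.Vec.Properties using (lookup∘tabulate; []=⇒lookup; lookup⇒[]=)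
  open import Algebra.Properties.CommutativeMonoid.Sum +-0-commutativeMonoid using (sum)
  open import Function using (_∘_)
  open import Function.Definitions using (Injective)
  open import Induction.WellFounded using (Acc; acc)
  open import Relation.Binary.PropositionalEquality
  open import Relation.Nullary using (¬_; Dec; yes; no; does; contradiction)
  open import Relation.Nullary.Decidable using (_×-dec_; ¬?; dec-true; decidable-stable)
  open import Relation.Unary using (Decidable)

  comprehension : ∀ {n} {P : Fin n → Set} → Decidable P → Subset n
  comprehension P? = tabulate (does ∘ P?)

  ∈-comprehension⁺ : ∀ {n} {P : Fin n → Set} (P? : Decidable P) {x} → P x → x ∈ comprehension P?
  ∈-comprehension⁺ P? {x} px =
    lookup⇒[]= x _ (trans (lookup∘tabulate (does ∘ P?) x) (dec-true (P? x) px))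

  ∈-comprehension⁻ : ∀ {n} {P : Fin n → Set} (P? : Decidable P) {x} → x ∈ comprehension P? → P x
  ∈-comprehension⁻ P? {x} x∈ with P? x | trans (sym (lookup∘tabulate (does ∘ P?) x)) ([]=⇒lookup x∈)
  ... | yes px | _  = px
  ... | no  _  | ()

  ∣p∪q∣+∣p∩q∣≡∣p∣+∣q∣ : ∀ {n} (p q : Subset n) → ∣ p ∪ q ∣ + ∣ p ∩ q ∣ ≡ ∣ p ∣ + ∣ q ∣
  ∣p∪q∣+∣p∩q∣≡∣p∣+∣q∣ []          []          = refl
  ∣p∪q∣+∣p∩q∣≡∣p∣+∣q∣ (true ∷ p)  (true ∷ q)  = cong suc (trans (+-suc _ _)
    (trans (cong suc (∣p∪q∣+∣p∩q∣≡∣p∣+∣q∣ p q)) (sym (+-suc _ _))))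
  ∣p∪q∣+∣p∩q∣≡∣p∣+∣q∣ (true ∷ p)  (false ∷ q) = cong suc (∣p∪q∣+∣p∩q∣≡∣p∣+∣q∣ p q)
  ∣p∪q∣+∣p∩q∣≡∣p∣+∣q∣ (false ∷ p) (true ∷ q)  =
    trans (cong suc (∣p∪q∣+∣p∩q∣≡∣p∣+∣q∣ p q)) (sym (+-suc _ _))
  ∣p∪q∣+∣p∩q∣≡∣p∣+∣q∣ (false ∷ p) (false ∷ q) = ∣p∪q∣+∣p∩q∣≡∣p∣+∣q∣ p q

  ∣p∣≡∣p∩q∣+∣p∩∁q∣ : ∀ {n} (p q : Subset n) → ∣ p ∣ ≡ ∣ p ∩ q ∣ + ∣ p ∩ ∁ q ∣
  ∣p∣≡∣p∩q∣+∣p∩∁q∣ []          []          = refl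
  ∣p∣≡∣p∩q∣+∣p∩∁q∣ (true ∷ p)  (true ∷ q)  = cong suc (∣p∣≡∣p∩q∣+∣p∩∁q∣ p q)
  ∣p∣≡∣p∩q∣+∣p∩∁q∣ (true ∷ p)  (false ∷ q) =
    trans (cong suc (∣p∣≡∣p∩q∣+∣p∩∁q∣ p q)) (sym (+-suc _ _))
  ∣p∣≡∣p∩q∣+∣p∩∁q∣ (false ∷ p) (true ∷ q)  = ∣p∣≡∣p∩q∣+∣p∩∁q∣ p q
  ∣p∣≡∣p∩q∣+∣p∩∁q∣ (false ∷ p) (false ∷ q) = ∣p∣≡∣p∩q∣+∣p∩∁q∣ p q

  0<∣p∣⇒Nonempty : ∀ {n} (p : Subset n) → 0 < ∣ p ∣ → Nonempty p
  0<∣p∣⇒Nonempty {n} p 0<∣p∣ with nonempty? p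
  ... | yes ne    = ne
  ... | no  empty = contradiction (trans (cong ∣_∣ (Empty-unique empty)) (∣⊥∣≡0 n)) (>⇒≢ 0<∣p∣)

  ∣p∣≤1+∣p-x∣ : ∀ {n} (p : Subset n) x → ∣ p ∣ ≤ suc ∣ p ∩ ∁ ⁅ x ⁆ ∣
  ∣p∣≤1+∣p-x∣ p x = begin
    ∣ p ∣                              ≡⟨ ∣p∣≡∣p∩q∣+∣p∩∁q∣ p ⁅ x ⁆ ⟩
    ∣ p ∩ ⁅ x ⁆ ∣ + ∣ p ∩ ∁ ⁅ x ⁆ ∣    ≤⟨ +-monoˡ-≤ _ (∣p∩q∣≤∣q∣ p ⁅ x ⁆) ⟩
    ∣ ⁅ x ⁆ ∣ + ∣ p ∩ ∁ ⁅ x ⁆ ∣        ≡⟨ cong (_+ ∣ p ∩ ∁ ⁅ x ⁆ ∣) (∣⁅x⁆∣≡1 x) ⟩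
    suc ∣ p ∩ ∁ ⁅ x ⁆ ∣                ∎
    where open ≤-Reasoning

  sum-mono-≤ : ∀ {n} {f g : Fin n → ℕ} → (∀ i → f i ≤ g i) → sum f ≤ sum g
  sum-mono-≤ {ℕ.zero} f≤g = ≤-refl
  sum-mono-≤ {suc n} f≤g = +-mono-≤ (f≤g zero) (sum-mono-≤ (f≤g ∘ suc))

  sum-mono-< : ∀ {n} {f g : Fin n → ℕ} → (∀ i → f i ≤ g i) → ∀ k → f k < g k → sum f < sum g
  sum-mono-< f≤g zero    fk<gk = +-mono-<-≤ fk<gk (sum-mono-≤ (f≤g ∘ suc))
  sum-mono-< f≤g (suc k) fk<gk = +-mono-≤-< (f≤g zero) (sum-mono-< (f≤g ∘ suc) k fk<gk)

  module _ {m n : ℕ} where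

    neighbour? : (R : Fin m → Subset n) (X : Subset m) → Decidable (λ y → ∃[ x ] (x ∈ X × y ∈ R x))
    neighbour? R X y = any? (λ x → (x ∈? X) ×-dec (y ∈? R x))

    neighbours : (Fin m → Subset n) → Subset m → Subset n
    neighbours R X = comprehension (neighbour? R X)

    ∈-neighbours⁺ : ∀ R {X x y} → x ∈ X → y ∈ R x → y ∈ neighbours R X
    ∈-neighbours⁺ R {X} x∈X y∈Rx = ∈-comprehension⁺ (neighbour? R X) (_ , x∈X , y∈Rx)

    ∈-neighbours⁻ : ∀ R {X y} → y ∈ neighbours R X → ∃[ x ] (x ∈ X × y ∈ R x)
    ∈-neighbours⁻ R {X} = ∈-comprehension⁻ (neighbour? R X)

    Violator : (Fin m → Subset n) → Set
    Violator R = ∃[ X ] ∣ neighbours R X ∣ < ∣ X ∣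

    violator? : ∀ R → Dec (Violator R)
    violator? R = anySubset? (λ X → ∣ neighbours R X ∣ <? ∣ X ∣)

    Transversal : (Fin m → Subset n) → Set
    Transversal R = ∃[ σ ] ((∀ x → σ x ∈ R x) × Injective _≡_ _≡_ σ)

    size : (Fin m → Subset n) → ℕ
    size R = sum (λ x → ∣ R x ∣)

    delete : (Fin m → Subset n) → Fin m → Fin n → (Fin m → Subset n)
    delete R x y z with z ≟ x
    ... | yes _ = R z - y
    ... | no  _ = R z

    delete-⊆ : ∀ R x y z → delete R x y z ⊆ R z
    delete-⊆ R x y z with z ≟ x
    ... | yes _ = p─q⊆p (R z) ⁅ y ⁆
    ... | no  _ = λ w∈ → w∈

    ∈-delete₁ : ∀ R {x y z w} → z ≢ x → w ∈ R z → w ∈ delete R x y z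
    ∈-delete₁ R {x} {z = z} z≢x w∈ with z ≟ x
    ... | yes z≡x = contradiction z≡x z≢x
    ... | no  _   = w∈

    ∈-delete₂ : ∀ R {x y z w} → w ≢ y → w ∈ R z → w ∈ delete R x y z
    ∈-delete₂ R {x} {z = z} w≢y w∈ with z ≟ x
    ... | yes _ = x∈p∧x≢y⇒x∈p-y w∈ w≢y
    ... | no  _ = w∈

    size-delete : ∀ R {x y} → y ∈ R x → size (delete R x y) < size R
    size-delete R {x} {y} y∈Rx = sum-mono-< (λ z → p⊆q⇒∣p∣≤∣q∣ (delete-⊆ R x y z)) x smaller
      where
      smaller : ∣ delete R x y x ∣ < ∣ R x ∣
      smaller with x ≟ x
      ... | yes _   = x∈p⇒∣p-x∣<∣p∣ y∈Rx
      ... | no  x≢x = contradiction refl x≢x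

    -- Away from `x` the deletion changes nothing, so a violator avoiding `x` would already violate
    -- Hall's condition for `R`.
    violator-∋ : ∀ R {x y} → ¬ Violator R → ((X , _) : Violator (delete R x y)) → x ∈ X
    violator-∋ R {x} ¬vio (X , ∣N∣<∣X∣) = decidable-stable (x ∈? X) λ x∉X →
      ¬vio (X , <-≤-trans (s≤s (p⊆q⇒∣p∣≤∣q∣ (λ y∈ →
        let z , z∈X , y∈Rz = ∈-neighbours⁻ R {X} y∈ in
        ∈-neighbours⁺ (delete R x _) z∈X (∈-delete₁ R (λ z≡x → x∉X (subst (_∈ X) z≡x z∈X)) y∈Rz)))) ∣N∣<∣X∣)

    -- Rado: if neither of two edges at x can be deleted, submodularity of
    -- X ↦ ∣ neighbours R X ∣ makes X₁ ∪ X₂ or (X₁ ∩ X₂) ∖ {x} a violator for R itself.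
    one-deletable : ∀ R {x y₁ y₂} → ¬ Violator R → y₁ ∈ R x → y₂ ∈ R x → y₁ ≢ y₂ →
                    Violator (delete R x y₁) → ¬ Violator (delete R x y₂)
    one-deletable R {x} {y₁} {y₂} ¬vio y₁∈ y₂∈ y₁≢y₂ v₁@(X₁ , N₁<X₁) v₂@(X₂ , N₂<X₂) =
      <-irrefl refl (begin-strict
        ∣ X₁ ∣ + ∣ X₂ ∣                          ≡⟨ sym (∣p∪q∣+∣p∩q∣≡∣p∣+∣q∣ X₁ X₂) ⟩
        ∣ X₁ ∪ X₂ ∣ + ∣ X₁ ∩ X₂ ∣                ≤⟨ +-monoʳ-≤ _ (∣p∣≤1+∣p-x∣ (X₁ ∩ X₂) x) ⟩
        ∣ X₁ ∪ X₂ ∣ + suc ∣ W ∣                  ≤⟨ +-mono-≤ (hall (X₁ ∪ X₂)) (s≤s (hall W)) ⟩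
        ∣ neighbours R (X₁ ∪ X₂) ∣ + suc ∣ neighbours R W ∣
                                                 ≤⟨ +-mono-≤ (p⊆q⇒∣p∣≤∣q∣ N∪) (s≤s (p⊆q⇒∣p∣≤∣q∣ N∩)) ⟩
        ∣ N₁ ∪ N₂ ∣ + suc ∣ N₁ ∩ N₂ ∣            ≡⟨ +-suc _ _ ⟩
        suc (∣ N₁ ∪ N₂ ∣ + ∣ N₁ ∩ N₂ ∣)          ≡⟨ cong suc (∣p∪q∣+∣p∩q∣≡∣p∣+∣q∣ N₁ N₂) ⟩
        suc (∣ N₁ ∣ + ∣ N₂ ∣)                    <⟨ s≤s (≤-reflexive (sym (+-suc _ _))) ⟩
        suc ∣ N₁ ∣ + suc ∣ N₂ ∣                  ≤⟨ +-mono-≤ N₁<X₁ N₂<X₂ ⟩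
        ∣ X₁ ∣ + ∣ X₂ ∣                          ∎)
      where
      open ≤-Reasoning
      R₁ = delete R x y₁
      R₂ = delete R x y₂
      N₁ = neighbours R₁ X₁
      N₂ = neighbours R₂ X₂
      W  = (X₁ ∩ X₂) ∩ ∁ ⁅ x ⁆

      hall : ∀ X → ∣ X ∣ ≤ ∣ neighbours R X ∣
      hall X = ≮⇒≥ (λ N<X → ¬vio (X , N<X))

      N∪ : neighbours R (X₁ ∪ X₂) ⊆ N₁ ∪ N₂
      N∪ {w} w∈ with ∈-neighbours⁻ R w∈
      ... | z , z∈ , w∈Rz with z ≟ x
      ...   | no z≢x = x∈p∪q⁺ ([ (λ z∈X₁ → inj₁ (∈-neighbours⁺ R₁ z∈X₁ (∈-delete₁ R z≢x w∈Rz)))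
                               , (λ z∈X₂ → inj₂ (∈-neighbours⁺ R₂ z∈X₂ (∈-delete₁ R z≢x w∈Rz)))
                               ]′ (x∈p∪q⁻ X₁ X₂ z∈))
      -- Both violators contain `x`, and since `y₁ ≢ y₂` the neighbour `w` of `x` survives in at
      -- least one of the two relations.
      ...   | yes refl with w ≟ y₁
      ...     | yes refl = x∈p∪q⁺ (inj₂ (∈-neighbours⁺ R₂ (violator-∋ R ¬vio v₂) (∈-delete₂ R y₁≢y₂ w∈Rz)))
      ...     | no w≢y₁  = x∈p∪q⁺ (inj₁ (∈-neighbours⁺ R₁ (violator-∋ R ¬vio v₁) (∈-delete₂ R w≢y₁ w∈Rz)))

      -- This is why `x` is taken out of the intersection: at other vertices both deletions agree
      -- with `R`, whereas `y₁` could be missing from `N₁` if `x` were kept. The loss of one element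
      -- is covered by the two strict inequalities of the violators.
      N∩ : neighbours R W ⊆ N₁ ∩ N₂
      N∩ {w} w∈ =
        let z , z∈W , w∈Rz = ∈-neighbours⁻ R w∈
            z∈X₁∩X₂ , z∈∁x = x∈p∩q⁻ (X₁ ∩ X₂) (∁ ⁅ x ⁆) z∈W
            z∈X₁ , z∈X₂    = x∈p∩q⁻ X₁ X₂ z∈X₁∩X₂
            z≢x            = x∉⁅y⁆⇒x≢y (x∈∁p⇒x∉p z∈∁x)
        in x∈p∩q⁺ (∈-neighbours⁺ R₁ z∈X₁ (∈-delete₁ R z≢x w∈Rz) ,
                   ∈-neighbours⁺ R₂ z∈X₂ (∈-delete₁ R z≢x w∈Rz))

    Branching : (Fin m → Subset n) → Set
    Branching R = ∃[ x ] ∃[ y₁ ] ∃[ y₂ ] (y₁ ∈ R x × y₂ ∈ R x × y₁ ≢ y₂)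

    branching? : ∀ R → Dec (Branching R)
    branching? R = any? λ x → any? λ y₁ → any? λ y₂ →
      (y₁ ∈? R x) ×-dec ((y₂ ∈? R x) ×-dec ¬? (y₁ ≟ y₂))

    -- Hall's condition for singletons gives each vertex a neighbour, and the lack of branching
    -- makes it unique, so `R` is the graph of a function `σ`. Hall's condition for pairs makes `σ`
    -- injective.
    unbranched⇒transversal : ∀ R → ¬ Violator R → ¬ Branching R → Transversal R
    unbranched⇒transversal R ¬vio ¬br = σ , σ∈ , inj
      where
      image : ∀ x → Nonempty (neighbours R ⁅ x ⁆)
      image x = 0<∣p∣⇒Nonempty (neighbours R ⁅ x ⁆) (<-≤-trans (≤-reflexive (sym (∣⁅x⁆∣≡1 x))) (≮⇒≥ (λ N< → ¬vio (⁅ x ⁆ , N<))))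
      σ : Fin m → Fin n
      σ x = proj₁ (image x)
      σ∈ : ∀ x → σ x ∈ R x
      σ∈ x with ∈-neighbours⁻ R (proj₂ (image x))
      ... | z , z∈⁅x⁆ , σx∈Rz = subst (λ z → σ x ∈ R z) (x∈⁅y⁆⇒x≡y x z∈⁅x⁆) σx∈Rz
      R⊆σ : ∀ {x y} → y ∈ R x → y ≡ σ x
      R⊆σ {x} {y} y∈ = decidable-stable (y ≟ σ x) (λ y≢ → ¬br (x , y , σ x , y∈ , σ∈ x , y≢))
      inj : Injective _≡_ _≡_ σ
      inj {x} {x′} eq = decidable-stable (x ≟ x′) λ x≢x′ → ¬vio (⁅ x ⁆ ∪ ⁅ x′ ⁆ , (begin-strict
        ∣ neighbours R (⁅ x ⁆ ∪ ⁅ x′ ⁆) ∣          ≤⟨ p⊆q⇒∣p∣≤∣q∣ single ⟩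
        ∣ ⁅ σ x ⁆ ∣                                ≡⟨ ∣⁅x⁆∣≡1 (σ x) ⟩
        1                                          <⟨ s≤s (s≤s z≤n) ⟩
        1 + 1                                      ≡⟨ sym (cong₂ _+_ (∣⁅x⁆∣≡1 x) (∣⁅x⁆∣≡1 x′)) ⟩
        ∣ ⁅ x ⁆ ∣ + ∣ ⁅ x′ ⁆ ∣                     ≡⟨ sym (∣p∪q∣+∣p∩q∣≡∣p∣+∣q∣ ⁅ x ⁆ ⁅ x′ ⁆) ⟩
        ∣ ⁅ x ⁆ ∪ ⁅ x′ ⁆ ∣ + ∣ ⁅ x ⁆ ∩ ⁅ x′ ⁆ ∣    ≡⟨ cong (∣ ⁅ x ⁆ ∪ ⁅ x′ ⁆ ∣ +_) (disjoint x≢x′) ⟩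
        ∣ ⁅ x ⁆ ∪ ⁅ x′ ⁆ ∣ + 0                     ≡⟨ +-identityʳ _ ⟩
        ∣ ⁅ x ⁆ ∪ ⁅ x′ ⁆ ∣                         ∎))
        where
        open ≤-Reasoning
        single : neighbours R (⁅ x ⁆ ∪ ⁅ x′ ⁆) ⊆ ⁅ σ x ⁆
        single y∈ with ∈-neighbours⁻ R y∈
        ... | z , z∈ , y∈Rz with x∈p∪q⁻ ⁅ x ⁆ ⁅ x′ ⁆ z∈
        ...   | inj₁ z∈x  rewrite x∈⁅y⁆⇒x≡y x z∈x | R⊆σ y∈Rz = x∈⁅x⁆ (σ x)
        ...   | inj₂ z∈x′ rewrite x∈⁅y⁆⇒x≡y x′ z∈x′ | R⊆σ y∈Rz | eq = x∈⁅x⁆ (σ x′)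
        disjoint : x ≢ x′ → ∣ ⁅ x ⁆ ∩ ⁅ x′ ⁆ ∣ ≡ 0
        disjoint x≢x′ = trans (cong ∣_∣ (Empty-unique λ (z , z∈) →
          let z∈x , z∈x′ = x∈p∩q⁻ ⁅ x ⁆ ⁅ x′ ⁆ z∈ in
          x≢x′ (trans (sym (x∈⁅y⁆⇒x≡y x z∈x)) (x∈⁅y⁆⇒x≡y x′ z∈x′)))) (∣⊥∣≡0 m)

    ⊆-transversal : ∀ {R S : Fin m → Subset n} → (∀ x → R x ⊆ S x) → Transversal R → Transversal S
    ⊆-transversal R⊆S (σ , σ∈ , inj) = σ , (λ x → R⊆S x (σ∈ x)) , inj

    -- As long as some vertex has two neighbours, one of the two edges can be deleted without
    -- creating a violator, by `one-deletable`. The recursion is on the number of edges, and a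
    -- transversal of a subrelation is one of `R`.
    ¬violator⇒transversal : ∀ R → Acc _<_ (size R) → ¬ Violator R → Transversal R
    ¬violator⇒transversal R (acc rec) ¬vio with branching? R
    ... | no ¬br = unbranched⇒transversal R ¬vio ¬br
    ... | yes (x , y₁ , y₂ , y₁∈ , y₂∈ , y₁≢y₂) with violator? (delete R x y₁)
    ...   | no ¬vio₁ = ⊆-transversal (delete-⊆ R x y₁)
                         (¬violator⇒transversal (delete R x y₁) (rec (size-delete R y₁∈)) ¬vio₁)
    ...   | yes vio₁ = ⊆-transversal (delete-⊆ R x y₂)
                         (¬violator⇒transversal (delete R x y₂) (rec (size-delete R y₂∈))
                           (one-deletable R ¬vio y₁∈ y₂∈ y₁≢y₂ vio₁))

    hall : ∀ R → Transversal R ⊎ Violator R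
    hall R with violator? R
    ... | yes vio = inj₂ vio
    ... | no ¬vio = inj₁ (¬violator⇒transversal R (<-wellFounded _) ¬vio)

-- Quadratic forms over the rationals and Schur complements.

module QuadraticForms where
  open import Data.Fin using (Fin; zero; suc)
  open import Data.Nat using (zero; suc)
  open import Data.Rational
  open import Data.Rational.Properties
  open import Data.Rational.Solver using (module +-*-Solver)
  open import Data.Vec.Functional using (_∷_)
  open import Function using (_∘_)
  open import Relation.Binary.PropositionalEquality
  open RationalLemmas
  open +-*-Solver

  dot : ∀ {n} → (Fin n → ℚ) → (Fin n → ℚ) → ℚ
  dot x y = sum (λ i → x i * y i)

  norm² : ∀ {n} → (Fin n → ℚ) → ℚ
  norm² x = dot x x

  form : ∀ {n} → (Fin n → Fin n → ℚ) → (Fin n → ℚ) → ℚ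
  form A x = dot x (λ i → dot (A i) x)

  Symmetric : ∀ {n} → (Fin n → Fin n → ℚ) → Set
  Symmetric A = ∀ i j → A i j ≡ A j i

  dot-cong : ∀ {n} {x x′ y y′ : Fin n → ℚ} → (∀ i → x i ≡ x′ i) → (∀ i → y i ≡ y′ i) → dot x y ≡ dot x′ y′
  dot-cong x≡x′ y≡y′ = sum-cong-≗ (λ i → cong₂ _*_ (x≡x′ i) (y≡y′ i))

  dot-comm : ∀ {n} (x y : Fin n → ℚ) → dot x y ≡ dot y x
  dot-comm x y = sum-cong-≗ (λ i → *-comm (x i) (y i))

  dot-scaleˡ : ∀ {n} s (x y : Fin n → ℚ) → dot (λ i → s * x i) y ≡ s * dot x y
  dot-scaleˡ s x y = trans (sum-cong-≗ (λ i → *-assoc s (x i) (y i))) (sym (*-distribˡ-sum s (λ i → x i * y i)))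

  dot-scaleʳ : ∀ {n} s (x y : Fin n → ℚ) → dot x (λ i → s * y i) ≡ s * dot x y
  dot-scaleʳ s x y = trans (dot-comm x _) (trans (dot-scaleˡ s y x) (cong (s *_) (dot-comm y x)))

  dot-+ʳ : ∀ {n} (x y z : Fin n → ℚ) → dot x (λ i → y i + z i) ≡ dot x y + dot x z
  dot-+ʳ x y z = trans (sum-cong-≗ (λ i → *-distribˡ-+ (x i) (y i) (z i))) (∑-distrib-+ (λ i → x i * y i) _)

  dot-+ˡ : ∀ {n} (x y z : Fin n → ℚ) → dot (λ i → x i + y i) z ≡ dot x z + dot y z
  dot-+ˡ x y z = trans (dot-comm _ z) (trans (dot-+ʳ z x y) (cong₂ _+_ (dot-comm z x) (dot-comm z y)))

  dot-negˡ : ∀ {n} (x y : Fin n → ℚ) → dot (λ i → - x i) y ≡ - dot x y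
  dot-negˡ x y = trans (sum-cong-≗ (λ i → sym (neg-distribˡ-* (x i) (y i)))) (sum-neg (λ i → x i * y i))

  dot-negʳ : ∀ {n} (x y : Fin n → ℚ) → dot x (λ i → - y i) ≡ - dot x y
  dot-negʳ x y = trans (dot-comm x _) (trans (dot-negˡ y x) (cong -_ (dot-comm y x)))

  dot-δˡ : ∀ {n} (i : Fin n) x → dot (δ i) x ≡ x i
  dot-δˡ i x = sum-δˡ x i

  norm²-nonNeg : ∀ {n} (x : Fin n → ℚ) → 0ℚ ≤ norm² x
  norm²-nonNeg x = sum-nonNeg (λ i → 0≤p*p (x i))

  norm²-pos : ∀ {n} (x : Fin n → ℚ) i → 0ℚ < x i * x i → 0ℚ < norm² x
  norm²-pos x = sum-pos (λ i → 0≤p*p (x i))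

  border : ∀ {n} → (Fin (suc n) → Fin (suc n) → ℚ) → Fin n → ℚ
  border A j = A zero (suc j)

  corner : ∀ {n} → (Fin (suc n) → Fin (suc n) → ℚ) → Fin n → Fin n → ℚ
  corner A i j = A (suc i) (suc j)

  -- The Schur complement of the top left entry, multiplied by that entry to avoid division.
  schur : ∀ {n} → (Fin (suc n) → Fin (suc n) → ℚ) → Fin n → Fin n → ℚ
  schur A i j = A zero zero * A (suc i) (suc j) + - (A zero (suc i) * A zero (suc j))

  module _ {n} (A : Fin (suc n) → Fin (suc n) → ℚ) (A-sym : Symmetric A) where
    private
      a = A zero zero
      b = border A
      C = corner A

    form-∷ : ∀ x₀ x → form A (x₀ ∷ x) ≡ a * (x₀ * x₀) + (x₀ * dot b x + x₀ * dot b x) + form C x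
    form-∷ x₀ x = begin
      x₀ * (a * x₀ + dot b x) + dot x (λ i → A (suc i) zero * x₀ + dot (C i) x)
        ≡⟨ cong (_+_ (x₀ * (a * x₀ + dot b x))) (dot-+ʳ x (λ i → A (suc i) zero * x₀) (λ i → dot (C i) x)) ⟩
      x₀ * (a * x₀ + dot b x) + (dot x (λ i → A (suc i) zero * x₀) + form C x)
        ≡⟨ cong (λ z → x₀ * (a * x₀ + dot b x) + (z + form C x)) (trans
             (dot-cong {x = x} (λ _ → refl) (λ i → trans (*-comm _ x₀) (cong (x₀ *_) (A-sym (suc i) zero))))
             (trans (dot-scaleʳ x₀ x b) (cong (x₀ *_) (dot-comm x b)))) ⟩
      x₀ * (a * x₀ + dot b x) + (x₀ * dot b x + form C x)
        ≡⟨ solve 4 (λ x₀ a u F → x₀ :* (a :* x₀ :+ u) :+ (x₀ :* u :+ F)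
                     := a :* (x₀ :* x₀) :+ (x₀ :* u :+ x₀ :* u) :+ F) refl x₀ a (dot b x) (form C x) ⟩
      a * (x₀ * x₀) + (x₀ * dot b x + x₀ * dot b x) + form C x ∎
      where open ≡-Reasoning

    dot-schur : ∀ x i → dot (schur A i) x ≡ a * dot (C i) x + - (b i * dot b x)
    dot-schur x i = trans (dot-+ˡ (λ j → a * C i j) (λ j → - (b i * b j)) x) (cong₂ _+_ (dot-scaleˡ a (C i) x)
      (trans (dot-negˡ (λ j → b i * b j) x) (cong -_ (dot-scaleˡ (b i) b x))))

    form-schur : ∀ x → form (schur A) x ≡ a * form C x + - (dot b x * dot b x)
    form-schur x = begin
      dot x (λ i → dot (schur A i) x)
        ≡⟨ dot-cong {x = x} (λ _ → refl) (dot-schur x) ⟩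
      dot x (λ i → a * dot (C i) x + - (b i * dot b x))
        ≡⟨ dot-+ʳ x _ _ ⟩
      dot x (λ i → a * dot (C i) x) + dot x (λ i → - (b i * dot b x))
        ≡⟨ cong₂ _+_ (dot-scaleʳ a x _) (trans (dot-negʳ x _) (cong -_ (trans
             (dot-cong {x = x} (λ _ → refl) (λ i → *-comm (b i) (dot b x)))
             (trans (dot-scaleʳ (dot b x) x b) (cong (dot b x *_) (dot-comm x b)))))) ⟩
      a * form C x + - (dot b x * dot b x) ∎
      where open ≡-Reasoning

    -- Completing the square: this is `a` times the vector (-b·x / a, x), whose first coordinate
    -- makes it A-orthogonal to the first basis vector. Hence forms and kernel vectors of the Schur
    -- complement carry over to `A`.
    lift : (Fin n → ℚ) → Fin (suc n) → ℚ
    lift x = (- dot b x) ∷ (λ i → a * x i)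

    form-lift : ∀ x → form A (lift x) ≡ a * form (schur A) x
    form-lift x = begin
      form A (lift x)
        ≡⟨ form-∷ (- u) (λ i → a * x i) ⟩
      a * (- u * - u) + (- u * dot b (λ i → a * x i) + - u * dot b (λ i → a * x i)) + form C (λ i → a * x i)
        ≡⟨ cong₂ (λ s t → a * (- u * - u) + (- u * s + - u * s) + t) (dot-scaleʳ a b x)
             (trans (dot-scaleˡ a x _) (cong (a *_) (trans
               (dot-cong {x = x} (λ _ → refl) (λ i → dot-scaleʳ a (C i) x)) (dot-scaleʳ a x _)))) ⟩
      a * (- u * - u) + (- u * (a * u) + - u * (a * u)) + a * (a * F)
        ≡⟨ solve 3 (λ a u F → a :* (:- u :* :- u) :+ (:- u :* (a :* u) :+ :- u :* (a :* u)) :+ a :* (a :* F)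
                     := a :* (a :* F :+ :- (u :* u))) refl a u F ⟩
      a * (a * F + - (u * u))
        ≡⟨ cong (a *_) (sym (form-schur x)) ⟩
      a * form (schur A) x ∎
      where
      open ≡-Reasoning
      u = dot b x
      F = form C x

    dot-lift-zero : ∀ x → dot (A zero) (lift x) ≡ 0ℚ
    dot-lift-zero x = trans (cong (_+_ (a * - dot b x)) (dot-scaleʳ a b x))
      (solve 2 (λ a u → a :* :- u :+ a :* u := con 0ℚ) refl a (dot b x))

    dot-lift-suc : ∀ x i → dot (A (suc i)) (lift x) ≡ dot (schur A i) x
    dot-lift-suc x i = begin
      A (suc i) zero * - u + dot (C i) (λ j → a * x j)
        ≡⟨ cong₂ _+_ (cong (_* - u) (A-sym (suc i) zero)) (dot-scaleʳ a (C i) x) ⟩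
      b i * - u + a * dot (C i) x
        ≡⟨ solve 4 (λ β u a s → β :* :- u :+ a :* s := a :* s :+ :- (β :* u)) refl (b i) u a (dot (C i) x) ⟩
      a * dot (C i) x + - (b i * u)
        ≡⟨ sym (dot-schur x i) ⟩
      dot (schur A i) x ∎
      where
      open ≡-Reasoning
      u = dot b x

    schur-sym : Symmetric (schur A)
    schur-sym i j = cong₂ (λ s t → a * s + - t) (A-sym (suc i) (suc j)) (*-comm (b i) (b j))

    -- If the top left entry vanishes, these vectors have form −4 b j ².
    isotropic : Fin n → Fin (suc n) → ℚ
    isotropic j = (- (C j j + 1ℚ)) ∷ (λ i → (b j + b j) * δ j i)

    -- With c the diagonal entry at `j`, the first coordinate -(c + 1) makes the cross terms -4b²(c
    -- + 1), which leaves -4b² after adding the corner term 4b²c. The multiple of `a` is kept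
    -- because over the reals `a` is only null, not equal to 0 at each index.
    form-isotropic : ∀ j → - form A (isotropic j) ≡
      (b j * b j + b j * b j + (b j * b j + b j * b j)) + a * - ((C j j + 1ℚ) * (C j j + 1ℚ))
    form-isotropic j = begin
      - form A (isotropic j)
        ≡⟨ cong -_ (form-∷ (- (c + 1ℚ)) y) ⟩
      - (a * (- (c + 1ℚ) * - (c + 1ℚ)) + (- (c + 1ℚ) * dot b y + - (c + 1ℚ) * dot b y) + form C y)
        ≡⟨ cong₂ (λ s t → - (a * (- (c + 1ℚ) * - (c + 1ℚ)) + (- (c + 1ℚ) * s + - (c + 1ℚ) * s) + t))
             (evaluate b) (trans (dot-scaleˡ s (δ j) _) (cong (s *_) (trans (dot-δˡ j _) (evaluate (C j))))) ⟩
      - (a * (- (c + 1ℚ) * - (c + 1ℚ)) + (- (c + 1ℚ) * (s * b j) + - (c + 1ℚ) * (s * b j)) + s * (s * c))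
        ≡⟨ solve 3 (λ a c β → :- (a :* (:- (c :+ con 1ℚ) :* :- (c :+ con 1ℚ))
               :+ (:- (c :+ con 1ℚ) :* ((β :+ β) :* β) :+ :- (c :+ con 1ℚ) :* ((β :+ β) :* β))
               :+ (β :+ β) :* ((β :+ β) :* c))
             := (β :* β :+ β :* β :+ (β :* β :+ β :* β)) :+ a :* :- ((c :+ con 1ℚ) :* (c :+ con 1ℚ)))
             refl a c (b j) ⟩
      (b j * b j + b j * b j + (b j * b j + b j * b j)) + a * - ((c + 1ℚ) * (c + 1ℚ)) ∎
      where
      open ≡-Reasoning
      c = C j j
      s = b j + b j
      y = λ i → s * δ j i
      evaluate : ∀ x → dot x y ≡ s * x j
      evaluate x = trans (dot-scaleʳ s x (δ j)) (cong (s *_) (trans (dot-comm x (δ j)) (dot-δˡ j x)))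

  -- A constant for a weak Cauchy-Schwarz inequality (b·x)² ≤ β|x|². It is larger than |b|², but it
  -- follows by plain induction and is at least 1, hence positive even for b = 0.
  dot²-bound : ∀ {n} → (Fin n → ℚ) → ℚ
  dot²-bound {zero}  b = 1ℚ
  dot²-bound {suc n} b = (β + β) + (b zero * b zero + b zero * b zero)
    where β = dot²-bound (b ∘ suc)

  1≤dot²-bound : ∀ {n} (b : Fin n → ℚ) → 1ℚ ≤ dot²-bound b
  1≤dot²-bound {zero}  b = ≤-refl
  1≤dot²-bound {suc n} b = begin
    1ℚ                  ≤⟨ 1≤β ⟩
    β                   ≡⟨ sym (trans (+-identityʳ (β + 0ℚ)) (+-identityʳ β)) ⟩
    (β + 0ℚ) + 0ℚ       ≤⟨ +-mono-≤ (+-monoʳ-≤ β (≤-trans (nonNegative⁻¹ 1ℚ) 1≤β))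
                            (0≤+ (0≤p*p (b zero)) (0≤p*p (b zero))) ⟩
    dot²-bound b        ∎
    where
    open ≤-Reasoning
    β = dot²-bound (b ∘ suc)
    1≤β = 1≤dot²-bound (b ∘ suc)

  -- Induction through (p + u)² = 2p² + 2u² - (p - u)², with p = b₀x₀ and u the dot product of the
  -- tails.
  dot²≤ : ∀ {n} (b x : Fin n → ℚ) → 0ℚ ≤ dot²-bound b * norm² x + - (dot b x * dot b x)
  dot²≤ {zero}  b x = ≤-refl
  dot²≤ {suc n} b x = subst (0ℚ ≤_)
    (solve 5 (λ β σ u b₀ x₀ →
         ((β :* σ :+ :- (u :* u)) :+ (β :* σ :+ :- (u :* u)))
         :+ ((b₀ :* b₀ :* σ :+ b₀ :* b₀ :* σ)
         :+ ((β :* (x₀ :* x₀) :+ β :* (x₀ :* x₀)) :+ (b₀ :* x₀ :- u) :* (b₀ :* x₀ :- u)))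
       := ((β :+ β) :+ (b₀ :* b₀ :+ b₀ :* b₀)) :* (x₀ :* x₀ :+ σ)
          :+ :- ((b₀ :* x₀ :+ u) :* (b₀ :* x₀ :+ u))) refl β σ u (b zero) (x zero))
    (0≤+ (0≤+ ih ih) (0≤+ (0≤+ bσ bσ) (0≤+ (0≤+ βx βx) (0≤p*p (b zero * x zero - u)))))
    where
    β  = dot²-bound (b ∘ suc)
    σ  = norm² (x ∘ suc)
    u  = dot (b ∘ suc) (x ∘ suc)
    ih = dot²≤ (b ∘ suc) (x ∘ suc)
    bσ = 0≤* (0≤p*p (b zero)) (norm²-nonNeg (x ∘ suc))
    βx = 0≤* (≤-trans (nonNegative⁻¹ 1ℚ) (1≤dot²-bound (b ∘ suc))) (0≤p*p (x zero))

-- Elimination over a ring with a conditional sign trichotomy.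

module SymmetricElimination where
  open import Data.Fin using (Fin; zero; suc)
  open import Data.Nat using (ℕ; zero; suc)
  open import Data.Product using (∃-syntax; _×_; _,_)
  open import Data.Rational using (ℚ; 0ℚ; 1ℚ; _+_; _*_; -_; _≤_)
  open import Data.Rational.Properties using (≤-refl; neg-distribʳ-*)
  open import Data.Rational.Solver using (module +-*-Solver)
  open import Data.Vec.Functional using (_∷_)
  open import Function using (_∘_)
  open import Relation.Binary.PropositionalEquality
  open RationalLemmas
  open QuadraticForms
  open +-*-Solver

  -- A ring of functions J → ℚ with a sign trichotomy that may be used while proving Answer.
  -- Taking J = ⊤ gives ℚ with decidable signs; taking the Cauchy sequences with Answer = ⊥
  -- gives the reals, whose trichotomy holds only up to double negation.
  record SignedRing (J Answer : Set) : Set₁ where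
    field
      Member Pos NonNeg Null : (J → ℚ) → Set
      member-const : ∀ q → Member (λ _ → q)
      member-+     : ∀ {f g} → Member f → Member g → Member (λ j → f j + g j)
      member-*     : ∀ {f g} → Member f → Member g → Member (λ j → f j * g j)
      member-neg   : ∀ {f} → Member f → Member (λ j → - f j)
      pos-resp     : ∀ {f g} → (∀ j → f j ≡ g j) → Pos f → Pos g
      nonNeg-resp  : ∀ {f g} → (∀ j → f j ≡ g j) → NonNeg f → NonNeg g
      null-resp    : ∀ {f g} → (∀ j → f j ≡ g j) → Null f → Null g
      1≤⇒pos       : ∀ {f} → (∀ j → 1ℚ ≤ f j) → Pos f
      0≤⇒nonNeg    : ∀ {f} → (∀ j → 0ℚ ≤ f j) → NonNeg f
      ≡0⇒null      : ∀ {f} → (∀ j → f j ≡ 0ℚ) → Null f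
      pos⇒nonNeg   : ∀ {f} → Pos f → NonNeg f
      pos+nonNeg   : ∀ {f g} → Pos f → NonNeg g → Pos (λ j → f j + g j)
      nonNeg+      : ∀ {f g} → NonNeg f → NonNeg g → NonNeg (λ j → f j + g j)
      pos*pos      : ∀ {f g} → Pos f → Pos g → Pos (λ j → f j * g j)
      pos*nonNeg   : ∀ {f g} → Member f → Pos f → NonNeg g → NonNeg (λ j → f j * g j)
      pos+null*    : ∀ {f g h} → Member h → Pos f → Null g → Pos (λ j → f j + g j * h j)
      sign         : ∀ {f} → Member f → (Pos (λ j → - f j) → Answer) → (Null f → Answer) →
                     (Pos f → Answer) → Answer

  module _ {J Answer : Set} (S : SignedRing J Answer) where
    open SignedRing S

    Vector : ℕ → Set
    Vector n = J → Fin n → ℚ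

    Matrix : ℕ → Set
    Matrix n = J → Fin n → Fin n → ℚ

    Memberᵥ : ∀ {n} → Vector n → Set
    Memberᵥ x = ∀ i → Member (λ j → x j i)

    Memberₘ : ∀ {n} → Matrix n → Set
    Memberₘ A = ∀ i k → Member (λ j → A j i k)

    -- Apartness from zero that does not commit to the sign of the coordinate.
    NonZero : ∀ {n} → Vector n → Set
    NonZero x = ∃[ i ] Pos (λ j → x j i * x j i)

    NegativeVector : ∀ {n} → Matrix n → Set
    NegativeVector A = ∃[ x ] (Memberᵥ x × NonZero x × Pos (λ j → - form (A j) (x j)))

    KernelVector : ∀ {n} → Matrix n → Set
    KernelVector A = ∃[ x ] (Memberᵥ x × NonZero x × (∀ i → Null (λ j → dot (A j i) (x j))))

    -- The bound A(x) ≥ (c/d)|x|² with its denominator cleared, uniform in `x`.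
    PositiveDefinite : ∀ {n} → Matrix n → Set
    PositiveDefinite A = ∃[ d ] ∃[ c ] (Member d × Pos d × Member c × Pos c ×
      (∀ x → Memberᵥ x → NonNeg (λ j → d j * form (A j) (x j) + - (c j * norm² (x j)))))

    member-sum : ∀ {n} {f : J → Fin n → ℚ} → Memberᵥ f → Member (λ j → sum (f j))
    member-sum {zero}  mf = member-const 0ℚ
    member-sum {suc n} mf = member-+ (mf zero) (member-sum (mf ∘ suc))

    member-dot : ∀ {n} {x y : Vector n} → Memberᵥ x → Memberᵥ y → Member (λ j → dot (x j) (y j))
    member-dot mx my = member-sum (λ i → member-* (mx i) (my i))

    member-dot²-bound : ∀ {n} {b : Vector n} → Memberᵥ b → Member (λ j → dot²-bound (b j))
    member-dot²-bound {zero}  mb = member-const 1ℚ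
    member-dot²-bound {suc n} mb = member-+ (member-+ mβ mβ)
      (member-+ (member-* (mb zero) (mb zero)) (member-* (mb zero) (mb zero)))
      where mβ = member-dot²-bound (mb ∘ suc)

    -- "Some coordinate is nonzero or all vanish", in continuation-passing form, because `sign` may
    -- be consulted only while proving `Answer`.
    all-null : ∀ {n} {b : Vector n} → Memberᵥ b → (NonZero b → Answer) →
               ((∀ i → Null (λ j → b j i)) → Answer) → Answer
    all-null {zero}  mb nonzero null = null (λ ())
    all-null {suc n} {b} mb nonzero null = sign (mb zero)
      (λ -b₀>0 → nonzero (zero , pos-resp (λ j → solve 1 (λ p → :- p :* :- p := p :* p) refl (b j zero))
                                   (pos*pos -b₀>0 -b₀>0)))
      (λ b₀≈0 → all-null (mb ∘ suc) (λ (i , bᵢ²>0) → nonzero (suc i , bᵢ²>0))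
                  (λ b≈0 → null (λ { zero → b₀≈0 ; (suc i) → b≈0 i })))
      (λ b₀>0 → nonzero (zero , pos*pos b₀>0 b₀>0))

    -- With w = a x₀ + b·x one has a A(x₀, x) = w² + S(x), where S is the scaled Schur
    -- complement; a² x₀² ≤ 2 w² + 2 (b·x)² then bounds the first coordinate.
    schur-positiveDefinite : ∀ {n} {A : Matrix (suc n)} → Memberₘ A → (∀ j → Symmetric (A j)) →
      Pos (λ j → A j zero zero) → PositiveDefinite (λ j → schur (A j)) → PositiveDefinite A
    schur-positiveDefinite {n} {A} mA symA a>0 (d , c , md , d>0 , mc , c>0 , bound) =
      (λ j → d j * (K j * a j)) , (λ j → d j * (c j * (a j * a j))) ,
      member-* md (member-* mK ma) , pos*pos d>0 (pos*pos K>0 a>0) ,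
      member-* md (member-* mc (member-* ma ma)) , pos*pos d>0 (pos*pos c>0 (pos*pos a>0 a>0)) ,
      λ x mx → nonNeg-resp (λ j → identity j (x j zero) (x j ∘ suc)) (nonNegative-rhs (λ j → x j ∘ suc) (mx ∘ suc) (λ j → x j zero))
      where
      a a² β L K : J → ℚ
      a j = A j zero zero
      a² j = a j * a j
      β j = dot²-bound (border (A j))
      -- `L` collects the coefficients of |x|² in a²(x₀² + |x|²) ≤ 2w² + 2β|x|² + a²|x|². In `K` the
      -- summand 2c pays for 2w², and `L * d` pays for L|x|² through d S(x) ≥ c|x|².
      L j = (β j + β j) + a² j
      K j = (c j + c j) + L j * d j
      ma = mA zero zero
      mβ = member-dot²-bound (λ i → mA zero (suc i))
      mL : Member L
      mL = member-+ (member-+ mβ mβ) (member-* ma ma)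
      mK : Member K
      mK = member-+ (member-+ mc mc) (member-* mL md)
      β>0 : Pos β
      β>0 = 1≤⇒pos (λ j → 1≤dot²-bound (border (A j)))
      L>0 : Pos L
      L>0 = pos+nonNeg (pos+nonNeg β>0 (pos⇒nonNeg β>0)) (0≤⇒nonNeg (λ j → 0≤p*p (a j)))
      K>0 : Pos K
      K>0 = pos+nonNeg (pos+nonNeg c>0 (pos⇒nonNeg c>0)) (pos⇒nonNeg (pos*pos L>0 d>0))

      u : Vector n → J → ℚ
      u x j = dot (border (A j)) (x j)
      slack : Vector n → J → ℚ
      slack x j = d j * form (schur (A j)) (x j) + - (c j * norm² (x j))
      w : Vector n → (J → ℚ) → J → ℚ
      w x x₀ j = a j * x₀ j + u x j
      excess : Vector n → J → ℚ
      excess x j = β j * norm² (x j) + - (u x j * u x j)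

      -- A certificate: the difference of the two sides of the claimed bound, as a combination of
      -- visibly nonnegative terms. The square of w + u is the defect in a²x₀² ≤ 2w² + 2u², and
      -- slack + c|x|² is d times the Schur form.
      rhs : Vector n → (J → ℚ) → J → ℚ
      rhs x x₀ j =
        d j * (c j * ((w x x₀ j + u x j) * (w x x₀ j + u x j))
               + (L j * (d j * (w x x₀ j * w x x₀ j))
               + (L j * slack x j
               + (c j + c j) * excess x j)))
        + (c j + c j) * (slack x j + c j * norm² (x j))

      nonNegative-rhs : ∀ x → Memberᵥ x → ∀ x₀ → NonNeg (rhs x x₀)
      nonNegative-rhs x mx x₀ = nonNeg+
        (pos*nonNeg md d>0 (nonNeg+
          (pos*nonNeg mc c>0 (0≤⇒nonNeg (λ j → 0≤p*p (w x x₀ j + u x j))))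
          (nonNeg+ (pos*nonNeg mL L>0 (pos*nonNeg md d>0 (0≤⇒nonNeg (λ j → 0≤p*p (w x x₀ j)))))
          (nonNeg+ (pos*nonNeg mL L>0 (bound x mx))
          (pos*nonNeg mcc cc>0 (0≤⇒nonNeg (λ j → dot²≤ (border (A j)) (x j))))))))
        (pos*nonNeg mcc cc>0 (nonNeg+ (bound x mx)
          (pos*nonNeg mc c>0 (0≤⇒nonNeg (λ j → norm²-nonNeg (x j))))))
        where
        mcc = member-+ mc mc
        cc>0 = pos+nonNeg c>0 (pos⇒nonNeg c>0)

      identity : ∀ j x₀ (x : Fin n → ℚ) → rhs (λ _ → x) (λ _ → x₀) j ≡
        d j * (K j * a j) * form (A j) (x₀ ∷ x) + - (d j * (c j * (a j * a j)) * norm² (x₀ ∷ x))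
      identity j x₀ x = trans
        (cong (λ s → let h = d j * s + - (c j * σ) in
                d j * (c j * ((a j * x₀ + v + v) * (a j * x₀ + v + v))
                       + (L j * (d j * ((a j * x₀ + v) * (a j * x₀ + v)))
                       + (L j * h + (c j + c j) * (β j * σ + - (v * v)))))
                + (c j + c j) * (h + c j * σ)) (form-schur (A j) (symA j) x))
        (trans
          (solve 8 (λ d c a β x₀ v σ F →
             let L = (β :+ β) :+ a :* a
                 h = d :* (a :* F :+ :- (v :* v)) :+ :- (c :* σ) in
             d :* (c :* ((a :* x₀ :+ v :+ v) :* (a :* x₀ :+ v :+ v))
                   :+ (L :* (d :* ((a :* x₀ :+ v) :* (a :* x₀ :+ v)))
                   :+ (L :* h :+ (c :+ c) :* (β :* σ :+ :- (v :* v)))))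
             :+ (c :+ c) :* (h :+ c :* σ)
             := d :* (((c :+ c) :+ L :* d) :* a) :* (a :* (x₀ :* x₀) :+ (x₀ :* v :+ x₀ :* v) :+ F)
                :+ :- (d :* (c :* (a :* a)) :* (x₀ :* x₀ :+ σ)))
             refl (d j) (c j) (a j) (β j) x₀ v σ F)
          (cong (λ s → d j * (K j * a j) * s + - (d j * (c j * (a j * a j)) * norm² (x₀ ∷ x)))
            (sym (form-∷ (A j) (symA j) x₀ x))))
        where
        v = dot (border (A j)) x
        σ = norm² x
        F = form (corner (A j)) x

    lift-nonZero : ∀ {n} {A : Matrix (suc n)} (symA : ∀ j → Symmetric (A j)) → Pos (λ j → A j zero zero) →
                   ∀ {x} → NonZero x → NonZero (λ j → lift (A j) (symA j) (x j))
    lift-nonZero {A = A} symA a>0 {x} (i , xᵢ²>0) = suc i , pos-resp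
      (λ j → solve 2 (λ a x → (a :* a) :* (x :* x) := (a :* x) :* (a :* x)) refl (A j zero zero) (x j i))
      (pos*pos (pos*pos a>0 a>0) xᵢ²>0)

    lift-member : ∀ {n} {A : Matrix (suc n)} (symA : ∀ j → Symmetric (A j)) → Memberₘ A →
                  ∀ {x} → Memberᵥ x → Memberᵥ (λ j → lift (A j) (symA j) (x j))
    lift-member symA mA mx zero    = member-neg (member-dot (mA zero ∘ suc) mx)
    lift-member symA mA mx (suc i) = member-* (mA zero zero) (mx i)

    -- Recursion on the pivot. A negative pivot makes the first basis vector negative; a null pivot
    -- gives an `isotropic` negative vector if its row is nonzero and otherwise puts the first basis
    -- vector in the kernel; a positive pivot passes to the Schur complement, from which vectors are
    -- lifted and definiteness is transferred.
    classify : ∀ {n} (A : Matrix n) → Memberₘ A → (∀ j → Symmetric (A j)) →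
               (NegativeVector A → Answer) → (KernelVector A → Answer) → (PositiveDefinite A → Answer) → Answer
    classify {zero} A mA symA neg ker pos = pos ((λ _ → 1ℚ) , (λ _ → 1ℚ) ,
      member-const 1ℚ , 1≤⇒pos (λ _ → ≤-refl) , member-const 1ℚ , 1≤⇒pos (λ _ → ≤-refl) ,
      λ x _ → 0≤⇒nonNeg (λ _ → ≤-refl))
    classify {suc n} A mA symA neg ker pos = sign (mA zero zero)
      (λ -a>0 → neg (e₀ , member-e₀ , e₀-nonZero , pos-resp (λ j → cong -_ (sym (form-e₀ j))) -a>0))
      (λ a≈0 → all-null (mA zero ∘ suc)
        (λ (k , bₖ²>0) → let 2bₖ² = pos+nonNeg bₖ²>0 (pos⇒nonNeg bₖ²>0)
                             4bₖ² = pos+nonNeg 2bₖ² (pos⇒nonNeg 2bₖ²)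
                             mc+1 = member-+ (mA (suc k) (suc k)) (member-const 1ℚ) in
          neg ((λ j → isotropic (A j) (symA j) k)
            , (λ { zero → member-neg mc+1
                 ; (suc i) → member-* (member-+ (mA zero (suc k)) (mA zero (suc k))) (member-const (δ k i)) })
            , (suc k , pos-resp (λ j → trans
                (solve 1 (λ β → β :* β :+ β :* β :+ (β :* β :+ β :* β)
                             := (β :+ β) :* con 1ℚ :* ((β :+ β) :* con 1ℚ)) refl (A j zero (suc k)))
                (cong (λ z → (A j zero (suc k) + A j zero (suc k)) * z * ((A j zero (suc k) + A j zero (suc k)) * z))
                  (sym (δ-refl k)))) 4bₖ²)
            , pos-resp (λ j → sym (form-isotropic (A j) (symA j) k))
                (pos+null* (member-neg (member-* mc+1 mc+1)) 4bₖ² a≈0)))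
        (λ b≈0 → ker (e₀ , member-e₀ , e₀-nonZero ,
          λ { zero    → null-resp (λ j → sym (dot-e₀ j zero)) a≈0
            ; (suc i) → null-resp (λ j → sym (trans (dot-e₀ j (suc i)) (symA j (suc i) zero))) (b≈0 i) })))
      (λ a>0 → classify (λ j → schur (A j))
        (λ i k → member-+ (member-* (mA zero zero) (mA (suc i) (suc k)))
                          (member-neg (member-* (mA zero (suc i)) (mA zero (suc k)))))
        (λ j → schur-sym (A j) (symA j))
        (λ (x , mx , x≠0 , -S>0) → neg ((λ j → lift (A j) (symA j) (x j)) , lift-member symA mA mx ,
          lift-nonZero symA a>0 x≠0 ,
          pos-resp (λ j → trans (sym (neg-distribʳ-* (A j zero zero) _)) (cong -_ (sym (form-lift (A j) (symA j) (x j)))))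
            (pos*pos a>0 -S>0)))
        (λ (x , mx , x≠0 , Sx≈0) → ker ((λ j → lift (A j) (symA j) (x j)) , lift-member symA mA mx ,
          lift-nonZero symA a>0 x≠0 ,
          λ { zero    → ≡0⇒null (λ j → dot-lift-zero (A j) (symA j) (x j))
            ; (suc i) → null-resp (λ j → sym (dot-lift-suc (A j) (symA j) (x j) i)) (Sx≈0 i) }))
        (λ S>0 → pos (schur-positiveDefinite mA symA a>0 S>0)))
      where
      e₀ : Vector (suc n)
      e₀ _ = δ zero
      member-e₀ : Memberᵥ e₀
      member-e₀ i = member-const (δ zero i)
      e₀-nonZero : NonZero e₀
      e₀-nonZero = zero , 1≤⇒pos (λ _ → ≤-refl)
      dot-e₀ : ∀ j i → dot (A j i) (e₀ j) ≡ A j i zero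
      dot-e₀ j i = trans (dot-comm (A j i) (δ zero)) (dot-δˡ zero (A j i))
      form-e₀ : ∀ j → form (A j) (e₀ j) ≡ A j zero zero
      form-e₀ j = trans (dot-δˡ zero (λ i → dot (A j i) (δ zero))) (dot-e₀ j zero)

-- Bisection for the supremum of the Rayleigh quotient.

module Bisection where
  open import Data.Fin using (Fin)
  open import Data.Nat using (ℕ; zero; suc)
  import Data.Nat as ℕ
  import Data.Nat.Properties as ℕ
  open import Data.Product using (∃-syntax; _×_; _,_; proj₁; proj₂)
  open import Data.Rational hiding (NonZero)
  open import Data.Rational.Properties
  open import Data.Rational.Solver using (module +-*-Solver)
  open import Data.Sum using (_⊎_; inj₁; inj₂)
  open import Data.Unit using (⊤; tt)
  open import Relation.Binary using (tri<; tri≈; tri>)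
  open import Relation.Binary.PropositionalEquality
  open import Defs using (IsCauchy; divide)
  open RationalLemmas
  open QuadraticForms
  open SymmetricElimination
  open +-*-Solver

  rationals : ∀ {Answer} → SignedRing ⊤ Answer
  rationals = record
    { Member       = λ _ → ⊤
    ; Pos          = λ f → 0ℚ < f tt
    ; NonNeg       = λ f → 0ℚ ≤ f tt
    ; Null         = λ f → f tt ≡ 0ℚ
    ; member-const = λ _ → tt
    ; member-+     = λ _ _ → tt
    ; member-*     = λ _ _ → tt
    ; member-neg   = λ _ → tt
    ; pos-resp     = λ f≡g → subst (0ℚ <_) (f≡g tt)
    ; nonNeg-resp  = λ f≡g → subst (0ℚ ≤_) (f≡g tt)
    ; null-resp    = λ f≡g f≡0 → trans (sym (f≡g tt)) f≡0
    ; 1≤⇒pos       = λ 1≤f → <-≤-trans (positive⁻¹ 1ℚ) (1≤f tt)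
    ; 0≤⇒nonNeg    = λ 0≤f → 0≤f tt
    ; ≡0⇒null      = λ f≡0 → f≡0 tt
    ; pos⇒nonNeg   = <⇒≤
    ; pos+nonNeg   = 0<+
    ; nonNeg+      = 0≤+
    ; pos*pos      = 0<*
    ; pos*nonNeg   = λ _ 0<f 0≤g → 0≤* (<⇒≤ 0<f) 0≤g
    ; pos+null*    = λ {f} {g} {h} _ 0<f g≡0 → subst (0ℚ <_) (sym (trans
                       (cong (λ z → f tt + z * h tt) g≡0)
                       (trans (cong (_+_ (f tt)) (*-zeroˡ (h tt))) (+-identityʳ (f tt))))) 0<f
    ; sign         = λ {f} _ neg null pos → decide (f tt) neg null pos
    }
    where
    decide : ∀ {Answer : Set} p → (0ℚ < - p → Answer) → (p ≡ 0ℚ → Answer) → (0ℚ < p → Answer) → Answer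
    decide p neg null pos with <-cmp p 0ℚ
    ... | tri< p<0 _ _ = neg (neg-antimono-< p<0)
    ... | tri≈ _ p≡0 _ = null p≡0
    ... | tri> _ _ 0<p = pos 0<p

  module _ {n} (Q : Fin n → Fin n → ℚ) where

    shift : ℚ → Fin n → Fin n → ℚ
    shift t i j = t * δ i j + - Q i j

    dot-shift : ∀ t i x → dot (shift t i) x ≡ t * x i + - dot (Q i) x
    dot-shift t i x = trans (dot-+ˡ (λ j → t * δ i j) (λ j → - Q i j) x)
      (cong₂ _+_ (trans (dot-scaleˡ t (δ i) x) (cong (t *_) (dot-δˡ i x))) (dot-negˡ (Q i) x))

    form-shift : ∀ t x → form (shift t) x ≡ t * norm² x + - form Q x
    form-shift t x = trans (dot-cong {x = x} (λ _ → refl) (λ i → dot-shift t i x))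
      (trans (dot-+ʳ x (λ i → t * x i) (λ i → - dot (Q i) x))
        (cong₂ _+_ (dot-scaleʳ t x x) (dot-negʳ x (λ i → dot (Q i) x))))

    shift-sym : Symmetric Q → ∀ t → Symmetric (shift t)
    shift-sym Q-sym t i j = cong₂ (λ a b → t * a + - b) (δ-sym i j) (Q-sym i j)

    -- `Lower` and `Upper` bracket the supremum of the Rayleigh quotient over rational vectors, with
    -- the quotient multiplied out.
    Lower : ℚ → Set
    Lower s = ∃[ x ] (0ℚ < norm² x × s * norm² x ≤ form Q x)

    Upper : ℚ → Set
    Upper t = ∀ x → form Q x ≤ t * norm² x

    lower≤upper : ∀ s t → Lower s → Upper t → s ≤ t
    lower≤upper s t (x , 0<x² , s≤) t≥ = *-cancelʳ-≤-pos (norm² x) {{positive 0<x²}} (≤-trans s≤ (t≥ x))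

    -- A negative or a kernel vector of t - Q has Rayleigh quotient at least `t`; definiteness of t
    -- - Q bounds every quotient by `t`.
    lower-or-upper : Symmetric Q → ∀ t → Lower t ⊎ Upper t
    lower-or-upper Q-sym t = classify rationals (λ _ → shift t) (λ _ _ → tt) (λ _ → shift-sym Q-sym t)
      (λ (x , _ , (i , 0<xᵢ²) , 0<-form) → inj₁ (x tt , norm²-pos (x tt) i 0<xᵢ² ,
        0≤q-p⇒p≤q (subst (0ℚ ≤_) (trans (cong -_ (form-shift t (x tt)))
          (solve 2 (λ p q → :- (p :+ :- q) := q :- p) refl (t * norm² (x tt)) (form Q (x tt)))) (<⇒≤ 0<-form))))
      (λ (x , _ , (i , 0<xᵢ²) , ker) → inj₁ (x tt , norm²-pos (x tt) i 0<xᵢ² ,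
        0≤q-p⇒p≤q (≤-reflexive (sym (begin-equality
          form Q (x tt) - t * norm² (x tt)       ≡⟨ solve 2 (λ p q → q :- p := :- (p :+ :- q)) refl (t * norm² (x tt)) (form Q (x tt)) ⟩
          - (t * norm² (x tt) + - form Q (x tt)) ≡⟨ cong -_ (sym (form-shift t (x tt))) ⟩
          - form (shift t) (x tt)                ≡⟨ cong -_ (sum-zero (λ i → trans (cong (x tt i *_) (ker i)) (*-zeroʳ (x tt i)))) ⟩
          - 0ℚ                                   ∎)))))
      (λ (d , c , _ , 0<d , _ , 0<c , bound) → inj₂ λ x → 0≤q-p⇒p≤q (subst (0ℚ ≤_) (form-shift t x)
        (*-cancelˡ-≤-pos (d tt) {{positive 0<d}} (begin
          d tt * 0ℚ                    ≡⟨ *-zeroʳ (d tt) ⟩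
          0ℚ                           ≤⟨ 0≤* (<⇒≤ 0<c) (norm²-nonNeg x) ⟩
          c tt * norm² x               ≤⟨ 0≤q-p⇒p≤q (bound (λ _ → x) (λ _ → tt)) ⟩
          d tt * form (shift t) x      ∎))))
      where
      open ≤-Reasoning

    -- With y = Qx, sum xᵢyᵢ ≤ xᵢ² + yᵢ² and yᵢ² ≤ βᵢ|x|² over i.
    upper-bound : ∃[ t ] Upper t
    upper-bound = 1ℚ + sum β , λ x → 0≤q-p⇒p≤q (subst (0ℚ ≤_) (total x)
      (sum-nonNeg (λ i → 0≤+ (dot²≤ (Q i) x) (square x i))))
      where
      β : Fin n → ℚ
      β i = dot²-bound (Q i)
      y : (Fin n → ℚ) → Fin n → ℚ
      y x i = dot (Q i) x
      square : ∀ x i → 0ℚ ≤ x i * x i + y x i * y x i - x i * y x i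
      square x i = subst (0ℚ ≤_)
        (solve 2 (λ a b → (a :- con ½ :* b) :* (a :- con ½ :* b) :+ (con ½ :+ con ½ :* con ½) :* (b :* b)
                       := a :* a :+ b :* b :- a :* b) refl (x i) (y x i))
        (0≤+ (0≤p*p (x i - ½ * y x i)) (0≤* (nonNegative⁻¹ (½ + ½ * ½)) (0≤p*p (y x i))))
      total : ∀ x → sum (λ i → (β i * norm² x + - (y x i * y x i)) + (x i * x i + y x i * y x i - x i * y x i))
                    ≡ (1ℚ + sum β) * norm² x - form Q x
      total x = begin
        sum (λ i → (β i * norm² x + - (y x i * y x i)) + (x i * x i + y x i * y x i - x i * y x i))
          ≡⟨ sum-cong-≗ (λ i → solve 4 (λ b σ a c → (b :* σ :+ :- (c :* c)) :+ (a :* a :+ c :* c :- a :* c)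
                                   := b :* σ :+ (a :* a :+ :- (a :* c))) refl (β i) (norm² x) (x i) (y x i)) ⟩
        sum (λ i → β i * norm² x + (x i * x i + - (x i * y x i)))
          ≡⟨ ∑-distrib-+ (λ i → β i * norm² x) (λ i → x i * x i + - (x i * y x i)) ⟩
        sum (λ i → β i * norm² x) + sum (λ i → x i * x i + - (x i * y x i))
          ≡⟨ cong₂ _+_ (sym (*-distribʳ-sum (norm² x) β))
               (trans (∑-distrib-+ (λ i → x i * x i) (λ i → - (x i * y x i)))
                      (cong (_+_ (norm² x)) (sum-neg (λ i → x i * y x i)))) ⟩
        sum β * norm² x + (norm² x + - form Q x)
          ≡⟨ solve 3 (λ b σ f → b :* σ :+ (σ :+ :- f) := (con 1ℚ :+ b) :* σ :- f) refl (sum β) (norm² x) (form Q x) ⟩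
        (1ℚ + sum β) * norm² x - form Q x ∎
        where open ≡-Reasoning

    record Bracket : Set where
      constructor bracket
      field
        lo hi   : ℚ
        lower   : Lower lo
        upper   : Upper hi

      width : ℚ
      width = hi - lo

    open Bracket public

    -- The decision is an argument, so that facts about the new bracket follow by cases on it
    -- without unfolding `lower-or-upper`.
    refine : (B : Bracket) → Lower (½ * (lo B + hi B)) ⊎ Upper (½ * (lo B + hi B)) → Bracket
    refine B (inj₁ l) = bracket (½ * (lo B + hi B)) (hi B) l (upper B)
    refine B (inj₂ u) = bracket (lo B) (½ * (lo B + hi B)) (lower B) u

    width-refine : ∀ B side → width (refine B side) ≡ ½ * width B
    width-refine B (inj₁ _) = solve 2 (λ s t → t :- con ½ :* (s :+ t) := con ½ :* (t :- s)) refl (lo B) (hi B)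
    width-refine B (inj₂ _) = solve 2 (λ s t → con ½ :* (s :+ t) :- s := con ½ :* (t :- s)) refl (lo B) (hi B)

    0≤width : ∀ B → 0ℚ ≤ width B
    0≤width B = p≤q⇒0≤q-p (lower≤upper (lo B) (hi B) (lower B) (upper B))

    module _ (Q-sym : Symmetric Q) (s₀ : ℚ) (s₀-lower : Lower s₀) where

      brackets : ℕ → Bracket
      brackets zero    = bracket s₀ (proj₁ upper-bound) s₀-lower (proj₂ upper-bound)
      brackets (suc m) = refine (brackets m) (lower-or-upper Q-sym (½ * (lo (brackets m) + hi (brackets m))))

      -- Halving beats the rate 1/(m + 1), because (m + 2)/2 ≤ m + 1; this weaker rate suffices and
      -- avoids powers of two.
      width-decay : ∀ m → width (brackets m) * ι (suc m) ≤ width (brackets 0)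
      width-decay zero    = ≤-reflexive (*-identityʳ _)
      width-decay (suc m) = begin
        width (brackets (suc m)) * ι (suc (suc m))
          ≡⟨ cong₂ _*_ (width-refine (brackets m) (lower-or-upper Q-sym (½ * (lo (brackets m) + hi (brackets m))))) (ι-suc (suc m)) ⟩
        ½ * w * (1ℚ + ι (suc m))
          ≤⟨ *-monoˡ-≤-nonNeg (½ * w) {{nonNegative (0≤* (nonNegative⁻¹ ½) (0≤width (brackets m)))}}
               (+-monoˡ-≤ (ι (suc m)) (ι-mono {1} {suc m} (ℕ.s≤s ℕ.z≤n))) ⟩
        ½ * w * (ι (suc m) + ι (suc m))
          ≡⟨ solve 2 (λ w k → con ½ :* w :* (k :+ k) := w :* k) refl w (ι (suc m)) ⟩
        w * ι (suc m)
          ≤⟨ width-decay m ⟩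
        width (brackets 0) ∎
        where
        open ≤-Reasoning
        w = width (brackets m)

      width-small : ∀ ε → 0ℚ < ε → ∃[ N ] (∀ m → N ℕ.≤ m → width (brackets m) ≤ ε)
      width-small ε 0<ε = N , λ m N≤m → *-cancelʳ-≤-pos (ι (suc m)) {{positive (ι-pos m)}} (begin
        width (brackets m) * ι (suc m)  ≤⟨ width-decay m ⟩
        W                               ≡⟨ sym (trans (cong (W *_) εη≡1) (*-identityʳ W)) ⟩
        W * (ε * η)                     ≡⟨ solve 3 (λ w e h → w :* (e :* h) := e :* (w :* h)) refl W ε η ⟩
        ε * (W * η)                     ≤⟨ *-monoˡ-≤-nonNeg ε {{nonNegative (<⇒≤ 0<ε)}} (≤-trans Wη≤N
                                             (ι-mono (ℕ.m≤n⇒m≤1+n N≤m))) ⟩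
        ε * ι (suc m)                   ∎)
        where
        open ≤-Reasoning
        W = width (brackets 0)
        ε⁻¹ = divide 1ℚ (positive⁻¹ 1ℚ) ε (positive 0<ε)
        η = proj₁ ε⁻¹
        εη≡1 = proj₂ (proj₂ ε⁻¹)
        N = proj₁ (≤ι (W * η))
        Wη≤N = proj₂ (≤ι (W * η))
        ι-pos : ∀ m → 0ℚ < ι (suc m)
        ι-pos m = <-≤-trans (positive⁻¹ 1ℚ) (ι-mono {1} {suc m} (ℕ.s≤s ℕ.z≤n))

      -- Upper ends are chosen so that every single term bounds the Rayleigh quotient from above,
      -- not only the limit.
      approximations : ℕ → ℚ
      approximations m = hi (brackets m)

      s₀≤approximations : ∀ m → s₀ ≤ approximations m
      s₀≤approximations m = lower≤upper s₀ (approximations m) s₀-lower (upper (brackets m))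

      -- Any lower end lies below any upper end, whichever brackets they come from.
      hi-hi≤width : ∀ B B′ → hi B - hi B′ ≤ width B
      hi-hi≤width B B′ = +-monoʳ-≤ (hi B) (neg-antimono-≤ (lower≤upper (lo B) (hi B′) (lower B) (upper B′)))

      approximations-cauchy : IsCauchy approximations
      approximations-cauchy ε 0<ε = let N , small = width-small ε 0<ε in N , λ m k N≤m N≤k → p≤q⇒∣p∣≤
        (≤-trans (hi-hi≤width (brackets m) (brackets k)) (small m N≤m))
        (subst (_≤ ε) (solve 2 (λ a b → a :- b := :- (b :- a)) refl (approximations k) (approximations m))
          (≤-trans (hi-hi≤width (brackets k) (brackets m)) (small k N≤k)))

-- Signs of Cauchy sequences.

module CauchySigns where
  open import Data.Empty using (⊥)
  open import Data.Nat using (ℕ)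
  import Data.Nat as ℕ
  import Data.Nat.Properties as ℕ
  open import Data.Product using (∃-syntax; _×_; _,_)
  open import Data.Rational
  open import Data.Rational.Properties
  open import Data.Rational.Solver using (module +-*-Solver)
  open import Relation.Binary.PropositionalEquality
  open import Defs using (IsCauchy; const-cauchy; +-cauchy; *-cauchy; cauchy⇒bounded; divide; ∣p*q∣-mono)
  open RationalLemmas
  open SymmetricElimination using (SignedRing)
  open +-*-Solver

  Eventually : (ℕ → Set) → Set
  Eventually P = ∃[ N ] (∀ n → N ℕ.≤ n → P n)

  always : ∀ {P : ℕ → Set} → (∀ n → P n) → Eventually P
  always p = 0 , λ n _ → p n

  eventually-map : ∀ {P Q : ℕ → Set} → (∀ n → P n → Q n) → Eventually P → Eventually Q
  eventually-map f (N , p) = N , λ n N≤n → f n (p n N≤n)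

  eventually-map₂ : ∀ {P Q R : ℕ → Set} → (∀ n → P n → Q n → R n) → Eventually P → Eventually Q → Eventually R
  eventually-map₂ f (M , p) (N , q) = M ℕ.⊔ N , λ n ≤n →
    f n (p n (ℕ.≤-trans (ℕ.m≤m⊔n M N) ≤n)) (q n (ℕ.≤-trans (ℕ.m≤n⊔m M N) ≤n))

  Pos NonNeg Null : (ℕ → ℚ) → Set
  Pos f    = ∃[ g ] (0ℚ < g × Eventually (λ n → g ≤ f n))
  NonNeg f = ∀ ε → 0ℚ < ε → Eventually (λ n → 0ℚ ≤ f n + ε)
  Null f   = ∀ ε → 0ℚ < ε → Eventually (λ n → ∣ f n ∣ ≤ ε)

  0<½* : ∀ {ε} → 0ℚ < ε → 0ℚ < ½ * ε
  0<½* = 0<* (positive⁻¹ ½)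

  ½+½ : ∀ ε → ½ * ε + ½ * ε ≡ ε
  ½+½ = solve 1 (λ ε → con ½ :* ε :+ con ½ :* ε := ε) refl

  neg-cauchy : ∀ {f} → IsCauchy f → IsCauchy (λ n → - f n)
  neg-cauchy {f} cf ε 0<ε = let N , close = cf ε 0<ε in N , λ m n N≤m N≤n → subst (_≤ ε)
    (trans (sym (∣-p∣≡∣p∣ (f m - f n)))
      (cong ∣_∣ (solve 2 (λ a b → :- (a :- b) := :- a :- :- b) refl (f m) (f n)))) (close m n N≤m N≤n)

  0<g≤p⇒0≤p : ∀ {g p} → 0ℚ < g → g ≤ p → 0ℚ ≤ p
  0<g≤p⇒0≤p 0<g g≤p = ≤-trans (<⇒≤ 0<g) g≤p

  pos+nonNeg : ∀ {f g} → Pos f → NonNeg g → Pos (λ n → f n + g n)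
  pos+nonNeg {f} {g} (a , 0<a , a≤f) g≥0 = ½ * a , 0<½* 0<a ,
    eventually-map₂ (λ n a≤fn 0≤gn+½a → 0≤q-p⇒p≤q (subst (0ℚ ≤_)
      (solve 3 (λ a f g → (f :- a) :+ (g :+ con ½ :* a) := f :+ g :- con ½ :* a) refl a (f n) (g n))
      (0≤+ (p≤q⇒0≤q-p a≤fn) 0≤gn+½a))) a≤f (g≥0 (½ * a) (0<½* 0<a))

  nonNeg+ : ∀ {f g} → NonNeg f → NonNeg g → NonNeg (λ n → f n + g n)
  nonNeg+ {f} {g} f≥0 g≥0 ε 0<ε = eventually-map₂ (λ n 0≤f 0≤g → subst (0ℚ ≤_)
      (solve 3 (λ ε f g → (f :+ con ½ :* ε) :+ (g :+ con ½ :* ε) := f :+ g :+ ε) refl ε (f n) (g n))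
      (0≤+ 0≤f 0≤g)) (f≥0 (½ * ε) (0<½* 0<ε)) (g≥0 (½ * ε) (0<½* 0<ε))

  pos*pos : ∀ {f g} → Pos f → Pos g → Pos (λ n → f n * g n)
  pos*pos {f} {g} (a , 0<a , a≤f) (b , 0<b , b≤g) = a * b , 0<* 0<a 0<b ,
    eventually-map₂ (λ n a≤fn b≤gn → 0≤q-p⇒p≤q (subst (0ℚ ≤_)
      (solve 4 (λ a b f g → (f :- a) :* g :+ a :* (g :- b) := f :* g :- a :* b) refl a b (f n) (g n))
      (0≤+ (0≤* (p≤q⇒0≤q-p a≤fn) (0<g≤p⇒0≤p 0<b b≤gn)) (0≤* (<⇒≤ 0<a) (p≤q⇒0≤q-p b≤gn))))) a≤f b≤g

  -- A Cauchy `f` is bounded by some B, so tolerating an error ε/B in `g` costs at most ε in the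
  -- product.
  pos*nonNeg : ∀ {f g} → IsCauchy f → Pos f → NonNeg g → NonNeg (λ n → f n * g n)
  pos*nonNeg {f} {g} cf (a , 0<a , a≤f) g≥0 ε 0<ε =
    let B , B>0 , f≤B    = cauchy⇒bounded f cf
        η , 0<η , Bη≡ε   = divide ε 0<ε B B>0
    in eventually-map₂ (λ n → estimate 0<η Bη≡ε)
         (eventually-map₂ (λ n a≤fn ∣fn∣≤B → 0<g≤p⇒0≤p 0<a a≤fn , ≤-trans (p≤∣p∣ (f n)) ∣fn∣≤B) a≤f f≤B)
         (g≥0 η 0<η)
    where
    estimate : ∀ {B η p q} → 0ℚ < η → B * η ≡ ε → 0ℚ ≤ p × p ≤ B → 0ℚ ≤ q + η → 0ℚ ≤ p * q + ε
    estimate {B} {η} {p} {q} 0<η Bη≡ε (0≤p , p≤B) 0≤q+η = subst (0ℚ ≤_)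
      (trans (solve 4 (λ B η p q → p :* (q :+ η) :+ (B :- p) :* η := p :* q :+ B :* η) refl B η p q)
             (cong (_+_ (p * q)) Bη≡ε))
      (0≤+ (0≤* 0≤p 0≤q+η) (0≤* (p≤q⇒0≤q-p p≤B) (<⇒≤ 0<η)))

  pos+null* : ∀ {f g h} → IsCauchy h → Pos f → Null g → Pos (λ n → f n + g n * h n)
  pos+null* {f} {g} {h} ch (a , 0<a , a≤f) g≈0 =
    let B , B>0 , h≤B     = cauchy⇒bounded h ch
        η , 0<η , Bη≡½a   = divide (½ * a) (0<½* 0<a) B B>0
    in ½ * a , 0<½* 0<a , eventually-map₂ (λ n a≤fn (∣hn∣≤B , ∣gn∣≤η) →
         estimate {f n} {g n} {h n} a≤fn (subst (∣ h n * g n ∣ ≤_) Bη≡½a (∣p*q∣-mono (h n) (g n) 0<η ∣hn∣≤B ∣gn∣≤η)))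
       a≤f (eventually-map₂ (λ _ → _,_) h≤B (g≈0 η 0<η))
    where
    open ≤-Reasoning
    estimate : ∀ {p q r} → a ≤ p → ∣ r * q ∣ ≤ ½ * a → ½ * a ≤ p + q * r
    estimate {p} {q} {r} a≤p ∣rq∣≤½a = begin
      ½ * a             ≡⟨ solve 1 (λ a → con ½ :* a := a :+ :- (con ½ :* a)) refl a ⟩
      a + - (½ * a)     ≤⟨ +-mono-≤ a≤p (neg-antimono-≤ ∣rq∣≤½a) ⟩
      p + - ∣ r * q ∣   ≤⟨ +-monoʳ-≤ p (-∣p∣≤p (r * q)) ⟩
      p + r * q         ≡⟨ cong (_+_ p) (*-comm r q) ⟩
      p + q * r         ∎

  -- If `f` stays within η of `f N` from N on, then |f N| > η would settle its sign. Refuting both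
  -- signs leaves |f n| ≤ 2η eventually, for every η.
  trichotomy : ∀ {f} → IsCauchy f → (Pos (λ n → - f n) → ⊥) → (Null f → ⊥) → (Pos f → ⊥) → ⊥
  trichotomy {f} cf ¬neg ¬null ¬pos = ¬null null
    where
    open ≤-Reasoning
    module _ {η N} (close : ∀ m n → N ℕ.≤ m → N ℕ.≤ n → ∣ f m - f n ∣ ≤ η) where
      above : η < f N → Pos f
      above η<fN = f N - η , p<q⇒0<q-p η<fN , N , λ n N≤n → 0≤q-p⇒p≤q
        (subst (0ℚ ≤_) (solve 3 (λ x y e → e :- (x :- y) := y :- (x :- e)) refl (f N) (f n) η)
          (p≤q⇒0≤q-p (≤-trans (p≤∣p∣ (f N - f n)) (close N n ℕ.≤-refl N≤n))))

      below : η < - f N → Pos (λ n → - f n)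
      below η<-fN = - f N - η , p<q⇒0<q-p η<-fN , N , λ n N≤n → 0≤q-p⇒p≤q
        (subst (0ℚ ≤_) (solve 3 (λ x y e → e :- (y :- x) := :- y :- (:- x :- e)) refl (f N) (f n) η)
          (p≤q⇒0≤q-p (≤-trans (p≤∣p∣ (f n - f N)) (close n N N≤n ℕ.≤-refl))))

      within : ∀ n → N ℕ.≤ n → ∣ f n ∣ ≤ η + η
      within n N≤n = begin
        ∣ f n ∣                    ≡⟨ cong ∣_∣ (solve 2 (λ x y → x := (x :- y) :+ y) refl (f n) (f N)) ⟩
        ∣ (f n - f N) + f N ∣      ≤⟨ ∣p+q∣≤∣p∣+∣q∣ (f n - f N) (f N) ⟩
        ∣ f n - f N ∣ + ∣ f N ∣    ≤⟨ +-mono-≤ (close n N N≤n ℕ.≤-refl)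
                                        (p≤q⇒∣p∣≤ (≮⇒≥ (λ η<fN → ¬pos (above η<fN)))
                                                  (≮⇒≥ (λ η<-fN → ¬neg (below η<-fN)))) ⟩
        η + η                      ∎

    null : Null f
    null ε 0<ε = let N , close = cf (½ * ε) (0<½* 0<ε) in
      N , λ n N≤n → subst (∣ f n ∣ ≤_) (½+½ ε) (within close n N≤n)

  reals : SignedRing ℕ ⊥
  reals = record
    { Member       = IsCauchy
    ; Pos          = Pos
    ; NonNeg       = NonNeg
    ; Null         = Null
    ; member-const = const-cauchy
    ; member-+     = λ {f} {g} → +-cauchy f g
    ; member-*     = λ {f} {g} → *-cauchy f g
    ; member-neg   = λ {f} → neg-cauchy {f}
    ; pos-resp     = λ f≡g (a , 0<a , a≤f) → a , 0<a , eventually-map (λ n → subst (a ≤_) (f≡g n)) a≤f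
    ; nonNeg-resp  = λ f≡g f≥0 ε 0<ε → eventually-map (λ n → subst (λ z → 0ℚ ≤ z + ε) (f≡g n)) (f≥0 ε 0<ε)
    ; null-resp    = λ f≡g f≈0 ε 0<ε → eventually-map (λ n → subst (λ z → ∣ z ∣ ≤ ε) (f≡g n)) (f≈0 ε 0<ε)
    ; 1≤⇒pos       = λ 1≤f → 1ℚ , positive⁻¹ 1ℚ , always 1≤f
    ; 0≤⇒nonNeg    = λ 0≤f ε 0<ε → always (λ n → 0≤+ (0≤f n) (<⇒≤ 0<ε))
    ; ≡0⇒null      = λ f≡0 ε 0<ε → always (λ n → subst (λ z → ∣ z ∣ ≤ ε) (sym (f≡0 n)) (<⇒≤ 0<ε))
    ; pos⇒nonNeg   = λ (a , 0<a , a≤f) ε 0<ε → eventually-map (λ n a≤fn → 0≤+ (0<g≤p⇒0≤p 0<a a≤fn) (<⇒≤ 0<ε)) a≤f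
    ; pos+nonNeg   = λ {f} {g} → pos+nonNeg {f} {g}
    ; nonNeg+      = λ {f} {g} → nonNeg+ {f} {g}
    ; pos*pos      = λ {f} {g} → pos*pos {f} {g}
    ; pos*nonNeg   = λ {f} {g} → pos*nonNeg {f} {g}
    ; pos+null*    = λ {f} {g} {h} → pos+null* {f} {g} {h}
    ; sign         = trichotomy
    }

-- The supremum of the Rayleigh quotient as an eigenvalue.

module LargestEigenvalue where
  open import Data.Empty using (⊥)
  open import Data.Fin using (Fin)
  open import Data.List using (tabulate; allFin)
  open import Data.Nat using (ℕ; zero; suc)
  import Data.Nat as ℕ
  import Data.Nat.Properties as ℕ
  open import Data.Product using (_×_; _,_)
  open import Data.Rational hiding (NonZero)
  open import Data.Rational.Properties
  open import Data.Rational.Solver using (module +-*-Solver)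
  open import Function using (_∘_; id)
  open import Relation.Binary.PropositionalEquality
  open import Relation.Nullary using (¬_)
  import Defs
  open import Defs using (ℝ; mkℝ; seq; mk≃; close; almost-≤; mk<; ∑; 0ℝ; fromℚ; IsEigenvalue; IsLargestEigenvalue; divide)
  open RationalLemmas
  open QuadraticForms
  open SymmetricElimination
  open Bisection
  open CauchySigns
  open +-*-Solver

  seq-∑-tabulate : ∀ {A : Set} {n} (g : Fin n → A) (f : A → ℝ) m →
                   seq (∑ (tabulate g) f) m ≡ sum (λ i → seq (f (g i)) m)
  seq-∑-tabulate {n = zero}  g f m = refl
  seq-∑-tabulate {n = suc n} g f m = cong (_+_ (seq (f (g Fin.zero)) m)) (seq-∑-tabulate (g ∘ Fin.suc) f m)

  -- Bounding one factor of x² by 1 and the other by g/2 contradicts g ≤ x² without taking a square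
  -- root.
  square-pos⇒≄0 : ∀ {x : ℝ} → Pos (λ m → seq x m * seq x m) → ¬ (x Defs.≃ 0ℝ)
  square-pos⇒≄0 {x} (g , 0<g , g≤x²) x≃0 =
    let η           = ½ * g
        N , bounds  = eventually-map₂ (λ m → contradictory {seq x m})
                        g≤x² (eventually-map₂ (λ _ → _,_) (close x≃0 1ℚ (positive⁻¹ 1ℚ)) (close x≃0 η (0<½* 0<g)))
    in bounds N ℕ.≤-refl
    where
    open ≤-Reasoning
    contradictory : ∀ {p} → g ≤ p * p → ∣ p - 0ℚ ∣ ≤ 1ℚ × ∣ p - 0ℚ ∣ ≤ ½ * g → ⊥
    contradictory {p} g≤p² (∣p∣≤1 , ∣p∣≤½g) = <-irrefl refl (begin-strict
      g                           ≤⟨ g≤p² ⟩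
      p * p                       ≤⟨ p≤∣p∣ (p * p) ⟩
      ∣ p * p ∣                   ≡⟨ cong (λ z → ∣ z * z ∣) (sym (+-identityʳ p)) ⟩
      ∣ (p - 0ℚ) * (p - 0ℚ) ∣     ≤⟨ Defs.∣p*q∣-mono (p - 0ℚ) (p - 0ℚ) (0<½* 0<g) ∣p∣≤1 ∣p∣≤½g ⟩
      1ℚ * (½ * g)                ≡⟨ trans (*-identityˡ (½ * g)) (sym (+-identityʳ (½ * g))) ⟩
      ½ * g + 0ℚ                  <⟨ +-monoʳ-< (½ * g) (0<½* 0<g) ⟩
      ½ * g + ½ * g               ≡⟨ ½+½ g ⟩
      g                           ∎)

  module _ {n} (M : Defs.Matrix n) (Q : Fin n → Fin n → ℚ) (Q-sym : Symmetric Q)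
           (M≡Q : ∀ i j m → seq (M i j) m ≡ Q i j) {s : ℚ} (s-lower : Lower Q s) where

    private
      t = approximations Q Q-sym s s-lower

    limit : ℝ
    limit = mkℝ t (approximations-cauchy Q Q-sym s s-lower)

    A : Matrix reals n
    A m = shift Q (t m)

    A-cauchy : Memberₘ reals A
    A-cauchy i j = Defs.+-cauchy (λ m → t m * δ i j) (λ _ → - Q i j)
      (Defs.*-cauchy t (λ _ → δ i j) (Defs.cauchy limit) (Defs.const-cauchy (δ i j))) (Defs.const-cauchy (- Q i j))

    -- The entries of `x` vary with the index, but at each index `t` is an upper end, so the form
    -- there is nonnegative on whatever rational vector occurs.
    no-negativeVector : ¬ NegativeVector reals A
    no-negativeVector (x , _ , _ , g , 0<g , N , g≤-form) = <-irrefl refl (begin-strict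
      0ℚ                                                    <⟨ 0<g ⟩
      g                                                     ≤⟨ g≤-form N ℕ.≤-refl ⟩
      - form (A N) (x N)                                    ≡⟨ cong -_ (form-shift Q (t N) (x N)) ⟩
      - (t N * norm² (x N) + - form Q (x N))                ≤⟨ neg-antimono-≤ (p≤q⇒0≤q-p
                                                                 (upper (brackets Q Q-sym s s-lower N) (x N))) ⟩
      0ℚ                                                    ∎)
      where open ≤-Reasoning

    -- On a vector witnessing that lo (brackets m) is a lower bound, the form of limit − Q is at
    -- most (hi − lo) times the squared norm, which is too small for m large.
    not-positiveDefinite : ¬ PositiveDefinite reals A
    not-positiveDefinite (d , c , d-cauchy , _ , _ , (g , 0<g , g≤c) , bound) =
      let D , D>0 , ∣d∣≤D       = Defs.cauchy⇒bounded d d-cauchy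
          -- Budget, with σ = |w|²: t - lo is at most two bracket widths, so d times the form is at
          -- most 2Dησ = gσ/2. Subtracting cσ ≥ gσ and allowing the error ε = gσ/4 leaves at most
          -- -gσ/4.
          η , 0<η , Dη≡¼g       = divide (½ * (½ * g)) (0<½* (0<½* 0<g)) D D>0
          K , small             = width-small Q Q-sym s s-lower η 0<η
          B                     = brackets Q Q-sym s s-lower K
          w , 0<w² , lo≤        = lower B
          gap m K≤m             = distance≤ {η} {brackets Q Q-sym s s-lower m} {B} (small m K≤m) (small K ℕ.≤-refl)
          ε                     = ½ * (½ * (g * norm² w))
          L , absurd            = eventually-map₂
            (λ m (g≤cm , ∣dm∣≤D) (tm≤ , bounded) → refute {D} {η} {d m} {c m} {t m} {lo B} {w} (<⇒≤ (positive⁻¹ D {{D>0}})) Dη≡¼g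
               (≤-trans (p≤∣p∣ (d m)) ∣dm∣≤D) g≤cm 0<w² lo≤ (upper (brackets Q Q-sym s s-lower m) w) tm≤ bounded)
            (eventually-map₂ (λ _ → _,_) g≤c ∣d∣≤D)
            (eventually-map₂ (λ _ → _,_) (K , gap)
              (bound (λ _ → w) (λ i → Defs.const-cauchy (w i)) ε (0<½* (0<½* (0<* 0<g 0<w²)))))
      in absurd L ℕ.≤-refl
      where
      distance≤ : ∀ {η} {B B′ : Bracket Q} → width B ≤ η → width B′ ≤ η → hi B - lo B′ ≤ η + η
      distance≤ {η} {B} {B′} wB≤η wB′≤η = 0≤q-p⇒p≤q (subst (0ℚ ≤_)
        (solve 5 (λ η s t s′ t′ → (η :- (t :- s)) :+ ((η :- (t′ :- s′)) :+ (t′ :- s)) := (η :+ η) :- (t :- s′))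
          refl η (lo B) (hi B) (lo B′) (hi B′))
        (0≤+ (p≤q⇒0≤q-p wB≤η) (0≤+ (p≤q⇒0≤q-p wB′≤η)
          (p≤q⇒0≤q-p (lower≤upper Q (lo B) (hi B′) (lower B) (upper B′))))))

      refute : ∀ {D η d c t s w} → 0ℚ ≤ D → D * η ≡ ½ * (½ * g) → d ≤ D → g ≤ c →
               0ℚ < norm² w → s * norm² w ≤ form Q w → form Q w ≤ t * norm² w → t - s ≤ η + η →
               0ℚ ≤ d * form (shift Q t) w + - (c * norm² w) + ½ * (½ * (g * norm² w)) → ⊥
      refute {D} {η} {d} {c} {t} {s} {w} 0≤D Dη≡¼g d≤D g≤c 0<σ sσ≤F F≤tσ t-s≤2η 0≤ = <-irrefl refl (begin-strict
        0ℚ                                    ≤⟨ 0≤+ (subst (λ z → 0ℚ ≤ d * z + - (c * σ) + ¼gσ) (form-shift Q t w) 0≤)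
                                                (0≤+ (0≤* (p≤q⇒0≤q-p d≤D) (p≤q⇒0≤q-p F≤tσ))
                                                (0≤+ (0≤* 0≤D (0≤+ (0≤* (p≤q⇒0≤q-p t-s≤2η) (<⇒≤ 0<σ)) (p≤q⇒0≤q-p sσ≤F)))
                                                     (0≤* (p≤q⇒0≤q-p g≤c) (<⇒≤ 0<σ)))) ⟩
        _                                     ≡⟨ solve 9 (λ D η d c t s g σ F →
            (d :* (t :* σ :+ :- F) :+ :- (c :* σ) :+ con ½ :* (con ½ :* (g :* σ)))
            :+ ((D :- d) :* (t :* σ :- F)
            :+ (D :* ((η :+ η :- (t :- s)) :* σ :+ (F :- s :* σ))
            :+ (c :- g) :* σ))
            := (D :* η :+ D :* η) :* σ :+ con ½ :* (con ½ :* (g :* σ)) :- g :* σ) refl D η d c t s g σ F ⟩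
        (D * η + D * η) * σ + ¼gσ - g * σ     ≡⟨ cong (λ z → (z + z) * σ + ¼gσ - g * σ) Dη≡¼g ⟩
        (½ * (½ * g) + ½ * (½ * g)) * σ + ¼gσ - g * σ
                                              ≡⟨ solve 2 (λ g σ →
            (con ½ :* (con ½ :* g) :+ con ½ :* (con ½ :* g)) :* σ :+ con ½ :* (con ½ :* (g :* σ)) :- g :* σ
            := :- (con ½ :* (con ½ :* (g :* σ)))) refl g σ ⟩
        - ¼gσ                                 <⟨ neg-antimono-< (0<½* (0<½* (0<* 0<g 0<σ))) ⟩
        0ℚ                                    ∎)
        where
        open ≤-Reasoning
        σ = norm² w
        F = form Q w
        ¼gσ = ½ * (½ * (g * σ))

    kernelVector⇒eigenvalue : KernelVector reals A → IsEigenvalue M limit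
    kernelVector⇒eigenvalue (x , x-cauchy , (k , xₖ²>0) , Ax≈0) = v ,
      (λ v≃0 → square-pos⇒≄0 {v k} xₖ²>0 (v≃0 k)) ,
      λ i → mk≃ λ ε 0<ε → eventually-map (λ m → subst (_≤ ε) (residual i m)) (Ax≈0 i ε 0<ε)
      where
      v : Fin n → ℝ
      v i = mkℝ (λ m → x m i) (x-cauchy i)
      residual : ∀ i m → ∣ dot (A m i) (x m) ∣ ≡ ∣ seq (∑ (allFin n) (λ j → M i j Defs.* v j)) m - t m * x m i ∣
      residual i m = begin
        ∣ dot (A m i) (x m) ∣                            ≡⟨ cong ∣_∣ (dot-shift Q (t m) i (x m)) ⟩
        ∣ t m * x m i + - dot (Q i) (x m) ∣              ≡⟨ sym (∣-p∣≡∣p∣ _) ⟩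
        ∣ - (t m * x m i + - dot (Q i) (x m)) ∣          ≡⟨ cong ∣_∣ (solve 2 (λ a b → :- (a :+ :- b) := b :- a) refl
                                                              (t m * x m i) (dot (Q i) (x m))) ⟩
        ∣ dot (Q i) (x m) - t m * x m i ∣                ≡⟨ cong (λ z → ∣ z - t m * x m i ∣) (sym (trans
                                                              (seq-∑-tabulate id (λ j → M i j Defs.* v j) m)
                                                              (sum-cong-≗ (λ j → cong (_* x m j) (M≡Q i j m))))) ⟩
        ∣ seq (∑ (allFin n) (λ j → M i j Defs.* v j)) m - t m * x m i ∣ ∎
        where open ≡-Reasoning

    limit-eigenvalue : ¬ ¬ IsEigenvalue M limit
    limit-eigenvalue ¬eigen = classify reals A A-cauchy (λ m → shift-sym Q Q-sym (t m))
      no-negativeVector (λ ker → ¬eigen (kernelVector⇒eigenvalue ker)) not-positiveDefinite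

    -- The goal is a negation, so the doubly negated eigenvalue can be used. At a late index s ≤ t ≤
    -- q + gap/2, against q + gap ≤ s.
    lower⇒≮ : ∀ q → IsLargestEigenvalue M q → ¬ (q Defs.< fromℚ s)
    lower⇒≮ q (_ , largest) (mk< gap 0<gap N q+gap≤s) = limit-eigenvalue λ eigen →
      let L , absurd = eventually-map₂ contradictory (almost-≤ (largest limit eigen) (½ * gap) (0<½* 0<gap)) (N , q+gap≤s)
      in absurd L ℕ.≤-refl
      where
      open ≤-Reasoning
      contradictory : ∀ m → t m ≤ seq q m + ½ * gap → seq q m + gap ≤ s → ⊥
      contradictory m t≤q+½gap q+gap≤s = <-irrefl refl (begin-strict
        s                              ≤⟨ s₀≤approximations Q Q-sym s s-lower m ⟩
        t m                            ≤⟨ t≤q+½gap ⟩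
        seq q m + ½ * gap              ≡⟨ sym (+-identityʳ _) ⟩
        seq q m + ½ * gap + 0ℚ         <⟨ +-monoʳ-< (seq q m + ½ * gap) (0<½* 0<gap) ⟩
        seq q m + ½ * gap + ½ * gap    ≡⟨ solve 2 (λ q g → q :+ con ½ :* g :+ con ½ :* g := q :+ g) refl (seq q m) gap ⟩
        seq q m + gap                  ≤⟨ q+gap≤s ⟩
        s                              ∎)

-- A fractional perfect matching from an injective choice of neighbours.

module FractionalMatchings where
  open import Data.Bool using (true; false; if_then_else_; T; T?)
  open import Data.Fin using (Fin; zero; suc; _≟_; _<?_)
  open import Data.Fin.Properties using (any?; <-cmp; <-irrefl)
  import Data.Fin as Fin
  open import Data.Integer using (+_)
  open import Data.List using (List; []; _∷_; _++_; map; mapMaybe; filter; tabulate; allFin; cartesianProduct)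
  open import Data.Maybe as Maybe using (Maybe; just; nothing; maybe′)
  open import Data.Nat using (zero; suc)
  open import Data.Product using (_×_; _,_)
  open import Data.Rational hiding (_≟_; _<?_)
  open import Data.Rational.Properties hiding (_≟_; _<?_; <-cmp; <-irrefl)
  open import Function using (_∘_; id)
  open import Function.Definitions using (Injective)
  open import Relation.Binary using (tri<; tri≈; tri>)
  open import Relation.Binary.PropositionalEquality
  open import Relation.Nullary using (¬_; Dec; yes; no; does; contradiction)
  open import Relation.Nullary.Decidable using (_×-dec_; _⊎-dec_; dec⇒maybe; dec-true; dec-false)
  open import Relation.Unary using (Decidable)
  import Defs
  open import Defs using (Graph; Edge; mkEdge; lo; hi; toEdge; edges; Γ; incident?; adj; no-loop; Adj; ℝ; 0ℝ; 1ℝ; seq; ∑; fromℚ; mk≤; mk≃; HasFractionalPerfectMatching)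
  open RationalLemmas

  listSum : ∀ {A : Set} → (A → ℚ) → List A → ℚ
  listSum f []       = 0ℚ
  listSum f (x ∷ xs) = f x + listSum f xs

  seq-∑-fromℚ : ∀ {A : Set} (f : A → ℚ) xs m → seq (∑ xs (fromℚ ∘ f)) m ≡ listSum f xs
  seq-∑-fromℚ f []       m = refl
  seq-∑-fromℚ f (x ∷ xs) m = cong (_+_ (f x)) (seq-∑-fromℚ f xs m)

  listSum-++ : ∀ {A : Set} (f : A → ℚ) xs ys → listSum f (xs ++ ys) ≡ listSum f xs + listSum f ys
  listSum-++ f []       ys = sym (+-identityˡ _)
  listSum-++ f (x ∷ xs) ys = trans (cong (_+_ (f x)) (listSum-++ f xs ys)) (sym (+-assoc (f x) _ _))

  listSum-map : ∀ {A B : Set} (f : B → ℚ) (g : A → B) xs → listSum f (map g xs) ≡ listSum (f ∘ g) xs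
  listSum-map f g []       = refl
  listSum-map f g (x ∷ xs) = cong (_+_ (f (g x))) (listSum-map f g xs)

  listSum-filter : ∀ {A : Set} {P : A → Set} (P? : Decidable P) (f : A → ℚ) xs →
                   listSum f (filter P? xs) ≡ listSum (λ x → if does (P? x) then f x else 0ℚ) xs
  listSum-filter P? f []       = refl
  listSum-filter P? f (x ∷ xs) with does (P? x)
  ... | true  = cong (_+_ (f x)) (listSum-filter P? f xs)
  ... | false = trans (listSum-filter P? f xs) (sym (+-identityˡ _))

  listSum-mapMaybe : ∀ {A B : Set} (f : B → ℚ) (g : A → Maybe B) xs →
                     listSum f (mapMaybe g xs) ≡ listSum (λ x → maybe′ f 0ℚ (g x)) xs
  listSum-mapMaybe f g []       = refl
  listSum-mapMaybe f g (x ∷ xs) with g x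
  ... | just y  = cong (_+_ (f y)) (listSum-mapMaybe f g xs)
  ... | nothing = trans (listSum-mapMaybe f g xs) (sym (+-identityˡ _))

  listSum-tabulate : ∀ {A : Set} {n} (f : A → ℚ) (g : Fin n → A) → listSum f (tabulate g) ≡ sum (f ∘ g)
  listSum-tabulate {n = zero}  f g = refl
  listSum-tabulate {n = suc n} f g = cong (_+_ (f (g zero))) (listSum-tabulate f (g ∘ suc))

  listSum-cartesianProduct : ∀ {A B : Set} (f : A × B → ℚ) xs ys →
    listSum f (cartesianProduct xs ys) ≡ listSum (λ x → listSum (λ y → f (x , y)) ys) xs
  listSum-cartesianProduct f []       ys = refl
  listSum-cartesianProduct f (x ∷ xs) ys = trans (listSum-++ f (map (x ,_) ys) _)
    (cong₂ _+_ (listSum-map f (x ,_) ys) (listSum-cartesianProduct f xs ys))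

  sum₂ : ∀ {n} → (Fin n → Fin n → ℚ) → ℚ
  sum₂ f = sum (λ u → sum (f u))

  sum₂-cong : ∀ {n} {f g : Fin n → Fin n → ℚ} → (∀ u v → f u v ≡ g u v) → sum₂ f ≡ sum₂ g
  sum₂-cong f≡g = sum-cong-≗ (λ u → sum-cong-≗ (f≡g u))

  sum₂-+ : ∀ {n} (f g : Fin n → Fin n → ℚ) → sum₂ (λ u v → f u v + g u v) ≡ sum₂ f + sum₂ g
  sum₂-+ f g = trans (sum-cong-≗ (λ u → ∑-distrib-+ (f u) (g u))) (∑-distrib-+ (λ u → sum (f u)) _)

  module _ {n} (G : Graph n) where

    ¬loop : ∀ u → ¬ Adj G u u
    ¬loop u u~u = subst T (no-loop G u) u~u

    edge? : ∀ u v → Dec (u Fin.< v × Adj G u v)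
    edge? u v = (u <? v) ×-dec T? (adj G u v)

    -- Turns sums over the edge list into double sums over vertices, where the order of summation
    -- can be exchanged.
    listSum-edges : (k : Fin n → Fin n → ℚ) →
      listSum (λ e → k (lo e) (hi e)) (edges G) ≡ sum₂ (λ u v → if does (edge? u v) then k u v else 0ℚ)
    listSum-edges k = begin
      listSum (λ e → k (lo e) (hi e)) (edges G)
        ≡⟨ listSum-mapMaybe _ (toEdge G) (cartesianProduct (allFin n) (allFin n)) ⟩
      listSum F (cartesianProduct (allFin n) (allFin n))
        ≡⟨ listSum-cartesianProduct F (allFin n) (allFin n) ⟩
      listSum (λ u → listSum (λ v → F (u , v)) (allFin n)) (allFin n)
        ≡⟨ listSum-tabulate (λ u → listSum (λ v → F (u , v)) (allFin n)) id ⟩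
      sum (λ u → listSum (λ v → F (u , v)) (allFin n))
        ≡⟨ sum-cong-≗ (λ u → trans (listSum-tabulate (λ v → F (u , v)) id) (sum-cong-≗ (λ v → entry u v (edge? u v)))) ⟩
      sum₂ (λ u v → if does (edge? u v) then k u v else 0ℚ) ∎
      where
      open ≡-Reasoning
      F : Fin n × Fin n → ℚ
      F p = maybe′ (λ e → k (lo e) (hi e)) 0ℚ (toEdge G p)
      entry : ∀ u v (d : Dec (u Fin.< v × Adj G u v)) →
        maybe′ (λ e → k (lo e) (hi e)) 0ℚ (Maybe.map (λ (u<v , u~v) → mkEdge {G = G} u v u<v u~v) (dec⇒maybe d))
        ≡ (if does d then k u v else 0ℚ)
      entry u v (yes _) = refl
      entry u v (no _)  = refl

  before : ∀ {n} → Fin n → Fin n → ℚ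
  before u v = if does (u <? v) then 1ℚ else 0ℚ

  before-yes : ∀ {n} {u v : Fin n} → u Fin.< v → before u v ≡ 1ℚ
  before-yes {u = u} {v} u<v = cong (if_then 1ℚ else 0ℚ) (dec-true (u <? v) u<v)

  before-no : ∀ {n} {u v : Fin n} → ¬ (u Fin.< v) → before u v ≡ 0ℚ
  before-no {u = u} {v} u≮v = cong (if_then 1ℚ else 0ℚ) (dec-false (u <? v) u≮v)

  before-total : ∀ {n} {u v : Fin n} → u ≢ v → before u v + before v u ≡ 1ℚ
  before-total {u = u} {v} u≢v with <-cmp u v
  ... | tri< u<v _ v≮u = cong₂ _+_ (before-yes u<v) (before-no v≮u)
  ... | tri≈ _ u≡v _   = contradiction u≡v u≢v
  ... | tri> u≮v _ v<u = cong₂ _+_ (before-no u≮v) (before-yes v<u)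

  before-total≤1 : ∀ {n} (u v : Fin n) → before u v + before v u ≤ 1ℚ
  before-total≤1 u v with u ≟ v
  ... | yes refl = subst (_≤ 1ℚ) (sym (cong₂ _+_ before-refl before-refl)) (nonNegative⁻¹ 1ℚ)
    where before-refl = before-no {u = u} (<-irrefl refl)
  ... | no u≢v   = ≤-reflexive (before-total u≢v)

  0≤before : ∀ {n} (u v : Fin n) → 0ℚ ≤ before u v
  0≤before u v with does (u <? v)
  ... | true  = nonNegative⁻¹ 1ℚ
  ... | false = ≤-refl

  sum-δ-injective : ∀ {n} (σ : Fin n → Fin n) → Injective _≡_ _≡_ σ → ∀ x → sum (λ v → δ (σ v) x) ≤ 1ℚ
  sum-δ-injective σ inj x with any? (λ v → σ v ≟ x)
  ... | yes (w , refl) = ≤-reflexive (trans (sum-cong-≗ same) (sum-δ w))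
    where
    same : ∀ v → δ (σ v) (σ w) ≡ δ w v
    same v with w ≟ v
    ... | yes refl = δ-refl (σ w)
    ... | no w≢v   = δ-≢ (λ eq → w≢v (sym (inj eq)))
  ... | no ∄w = subst (_≤ 1ℚ) (sym (sum-zero (λ v → δ-≢ (λ eq → ∄w (v , eq))))) (nonNegative⁻¹ 1ℚ)

  sum-½ : ∀ k → sum {k} (λ _ → ½) ≡ + k / 2
  sum-½ zero    = refl
  sum-½ (suc k) = trans (cong (_+_ ½) (sum-½ k)) (sym (/-suc k 1))

  ≤-const : ∀ (x : ℝ) p q → (∀ m → seq x m ≡ p) → p ≤ q → x Defs.≤ fromℚ q
  ≤-const x p q x≡p p≤q = mk≤ λ ε 0<ε → 0 , λ m _ →
    subst₂ _≤_ (trans (+-identityʳ p) (sym (x≡p m))) refl (+-mono-≤ p≤q (<⇒≤ 0<ε))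

  ≃-const : ∀ (x : ℝ) p → (∀ m → seq x m ≡ p) → x Defs.≃ fromℚ p
  ≃-const x p x≡p = mk≃ λ ε 0<ε → 0 , λ m _ →
    subst (_≤ ε) (sym (cong ∣_∣ (trans (cong (_- p) (x≡p m)) (+-inverseʳ p)))) (<⇒≤ 0<ε)

  module _ {n} (G : Graph n) (σ : Fin n → Fin n) (σ-adj : ∀ u → Adj G u (σ u)) (σ-inj : Injective _≡_ _≡_ σ) where

    -- Each vertex `u` puts ½ on the edge from `u` to `σ u`; an edge that `σ` traverses both ways
    -- receives 1.
    half : Fin n → Fin n → ℚ
    half u v = ½ * δ (σ u) v

    weight : Fin n → Fin n → ℚ
    weight u v = half u v + half v u

    0≤half : ∀ u v → 0ℚ ≤ half u v
    0≤half u v = 0≤* (nonNegative⁻¹ ½) (0≤δ (σ u) v)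

    half≤½ : ∀ u v → half u v ≤ ½
    half≤½ u v = *-monoˡ-≤-nonNeg ½ (δ≤1 (σ u) v)

    0≤weight : ∀ u v → 0ℚ ≤ weight u v
    0≤weight u v = 0≤+ (0≤half u v) (0≤half v u)

    weight-comm : ∀ u v → weight u v ≡ weight v u
    weight-comm u v = +-comm (half u v) (half v u)

    half-nonadjacent : ∀ {u v} → ¬ Adj G u v → half u v ≡ 0ℚ
    half-nonadjacent {u} ¬u~v = cong (½ *_) (δ-≢ (λ σu≡v → ¬u~v (subst (Adj G u) σu≡v (σ-adj u))))

    -- `σ` moves along edges, so `weight` vanishes on nonadjacent pairs and only the order condition
    -- survives, as a factor.
    weight-edge : ∀ u v → (if does (edge? G u v) then weight u v else 0ℚ) ≡ before u v * weight u v
    weight-edge u v = cases (u <? v) (T? (adj G u v))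
      where
      cases : (p : Dec (u Fin.< v)) (q : Dec (Adj G u v)) →
              (if does (p ×-dec q) then weight u v else 0ℚ) ≡ (if does p then 1ℚ else 0ℚ) * weight u v
      cases (no _)  _         = sym (*-zeroˡ (weight u v))
      cases (yes _) (yes _)   = sym (*-identityˡ (weight u v))
      cases (yes _) (no ¬u~v) = sym (trans (*-identityˡ (weight u v)) (cong₂ _+_ (half-nonadjacent ¬u~v)
        (half-nonadjacent (λ v~u → ¬u~v (subst T (Defs.adj-sym G v u) v~u)))))

    sum-half : ∀ u → sum (half u) ≡ ½
    sum-half u = trans (sym (*-distribˡ-sum ½ (δ (σ u)))) (trans (cong (½ *_) (sum-δ (σ u))) (*-identityʳ ½))

    total-weight : listSum (λ e → weight (lo e) (hi e)) (edges G) ≡ + n / 2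
    total-weight = begin
      listSum (λ e → weight (lo e) (hi e)) (edges G)
        ≡⟨ listSum-edges G weight ⟩
      sum₂ (λ u v → if does (edge? G u v) then weight u v else 0ℚ)
        ≡⟨ sum₂-cong (λ u v → trans (weight-edge u v) (*-distribˡ-+ (before u v) (half u v) (half v u))) ⟩
      sum₂ (λ u v → before u v * half u v + before u v * half v u)
        ≡⟨ sum₂-+ (λ u v → before u v * half u v) (λ u v → before u v * half v u) ⟩
      sum₂ (λ u v → before u v * half u v) + sum₂ (λ u v → before u v * half v u)
        -- Exchanging the roles of `u` and `v` in the second sum merges both into a sum over all
        -- ordered pairs; on the diagonal `half` vanishes, as there are no loops.
        ≡⟨ cong (_+_ (sum₂ (λ u v → before u v * half u v))) (∑-comm (λ u v → before u v * half v u)) ⟩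
      sum₂ (λ u v → before u v * half u v) + sum₂ (λ u v → before v u * half u v)
        ≡⟨ sym (sum₂-+ (λ u v → before u v * half u v) (λ u v → before v u * half u v)) ⟩
      sum₂ (λ u v → before u v * half u v + before v u * half u v)
        ≡⟨ sum₂-cong each ⟩
      sum₂ half
        ≡⟨ sum-cong-≗ sum-half ⟩
      sum {n} (λ _ → ½)
        ≡⟨ sum-½ n ⟩
      + n / 2 ∎
      where
      open ≡-Reasoning
      each : ∀ u v → before u v * half u v + before v u * half u v ≡ half u v
      each u v = trans (sym (*-distribʳ-+ (half u v) (before u v) (before v u))) (cases (u ≟ v))
        where
        cases : Dec (u ≡ v) → (before u v + before v u) * half u v ≡ half u v
        cases (yes refl) rewrite half-nonadjacent (¬loop G u) = *-zeroʳ (before u u + before u u)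
        cases (no u≢v)   = trans (cong (_* half u v) (before-total u≢v)) (*-identityˡ (half u v))

    at : Fin n → Fin n → Fin n → ℚ
    at x u v = if does ((x ≟ u) ⊎-dec (x ≟ v)) then weight u v else 0ℚ

    -- The indicator of a disjunction is at most the sum of the two indicators, and each delta then
    -- collapses one of the two summations.
    at-edge≤ : ∀ x u v → (if does (edge? G u v) then at x u v else 0ℚ) ≤
                         δ x u * (before u v * weight u v) + δ x v * (before u v * weight u v)
    at-edge≤ x u v = cases (edge? G u v) (x ≟ u) (x ≟ v)
      where
      c = before u v * weight u v
      0≤c : 0ℚ ≤ c
      0≤c = 0≤* (0≤before u v) (0≤weight u v)
      c≡ : u Fin.< v → c ≡ weight u v
      c≡ u<v = trans (cong (_* weight u v) (before-yes u<v)) (*-identityˡ (weight u v))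
      δc : Fin n → ℚ
      δc y = δ x y * c
      0≤δc : ∀ y → 0ℚ ≤ δc y
      0≤δc y = 0≤* (0≤δ x y) 0≤c
      δc-refl : ∀ {y} → x ≡ y → δc y ≡ c
      δc-refl refl = trans (cong (_* c) (δ-refl x)) (*-identityˡ c)
      cases : ∀ (d : Dec (u Fin.< v × Adj G u v)) (p : Dec (x ≡ u)) (q : Dec (x ≡ v)) →
              (if does d then (if does (p ⊎-dec q) then weight u v else 0ℚ) else 0ℚ) ≤ δc u + δc v
      cases (no _)          p         q         = 0≤+ (0≤δc u) (0≤δc v)
      cases (yes _)         (no _)    (no _)    = 0≤+ (0≤δc u) (0≤δc v)
      cases (yes (u<v , _)) (yes x≡u) q         = subst (_≤ δc u + δc v)
        (trans (+-identityʳ _) (trans (δc-refl x≡u) (c≡ u<v))) (+-monoʳ-≤ (δc u) (0≤δc v))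
      cases (yes (u<v , _)) (no _)    (yes x≡v) = subst (_≤ δc u + δc v)
        (trans (+-identityˡ _) (trans (δc-refl x≡v) (c≡ u<v))) (+-monoˡ-≤ (δc v) (0≤δc u))

    -- The vertex `x` contributes ½ through `σ x`, and by injectivity at most one `v` with σ v = x
    -- contributes another ½.
    vertex-weight≤1 : ∀ x → listSum (λ e → weight (lo e) (hi e)) (Γ G x) ≤ 1ℚ
    vertex-weight≤1 x = begin
      listSum (λ e → weight (lo e) (hi e)) (Γ G x)
        ≡⟨ listSum-filter (incident? x) _ (edges G) ⟩
      listSum (λ e → at x (lo e) (hi e)) (edges G)
        ≡⟨ listSum-edges G (at x) ⟩
      sum₂ (λ u v → if does (edge? G u v) then at x u v else 0ℚ)
        ≤⟨ sum-mono (λ u → sum-mono (at-edge≤ x u)) ⟩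
      sum₂ (λ u v → δ x u * c u v + δ x v * c u v)
        ≡⟨ sum₂-+ (λ u v → δ x u * c u v) (λ u v → δ x v * c u v) ⟩
      sum₂ (λ u v → δ x u * c u v) + sum₂ (λ u v → δ x v * c u v)
        ≡⟨ cong₂ _+_ (trans (sum-cong-≗ (λ u → sym (*-distribˡ-sum (δ x u) (c u)))) (sum-δˡ (λ u → sum (c u)) x))
                     (sum-cong-≗ (λ u → sum-δˡ (c u) x)) ⟩
      sum (c x) + sum (λ u → c u x)
        ≡⟨ sym (∑-distrib-+ (c x) (λ u → c u x)) ⟩
      sum (λ v → before x v * weight x v + before v x * weight v x)
        ≡⟨ sum-cong-≗ (λ v → trans (cong (λ z → before x v * weight x v + before v x * z) (weight-comm v x))
                                   (sym (*-distribʳ-+ (weight x v) (before x v) (before v x)))) ⟩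
      sum (λ v → (before x v + before v x) * weight x v)
        ≤⟨ sum-mono (λ v → *-monoʳ-≤-nonNeg (weight x v) {{nonNegative (0≤weight x v)}} (before-total≤1 x v)) ⟩
      sum (λ v → 1ℚ * weight x v)
        ≡⟨ sum-cong-≗ (λ v → *-identityˡ (weight x v)) ⟩
      sum (weight x)
        ≡⟨ ∑-distrib-+ (half x) (λ v → half v x) ⟩
      sum (half x) + sum (λ v → half v x)
        ≡⟨ cong₂ _+_ (sum-half x) (sym (*-distribˡ-sum ½ (λ v → δ (σ v) x))) ⟩
      ½ + ½ * sum (λ v → δ (σ v) x)
        ≤⟨ +-monoʳ-≤ ½ (*-monoˡ-≤-nonNeg ½ (sum-δ-injective σ σ-inj x)) ⟩
      ½ + ½ * 1ℚ
        ≡⟨⟩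
      1ℚ ∎
      where
      open ≤-Reasoning
      c : Fin n → Fin n → ℚ
      c u v = before u v * weight u v

    edge-weight : Edge G → ℚ
    edge-weight e = weight (lo e) (hi e)

    0≤edge-weight : ∀ e → 0ℝ Defs.≤ fromℚ (edge-weight e)
    0≤edge-weight e = ≤-const 0ℝ 0ℚ (edge-weight e) (λ _ → refl) (0≤weight (lo e) (hi e))

    edge-weight≤1 : ∀ e → fromℚ (edge-weight e) Defs.≤ 1ℝ
    edge-weight≤1 e = ≤-const (fromℚ (edge-weight e)) (edge-weight e) 1ℚ (λ _ → refl)
      (+-mono-≤ (half≤½ (lo e) (hi e)) (half≤½ (hi e) (lo e)))

    perfectMatching : HasFractionalPerfectMatching G
    perfectMatching = fromℚ ∘ edge-weight ,
      ((λ e → 0≤edge-weight e , edge-weight≤1 e) ,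
       (λ x → ≤-const (∑ (Γ G x) (fromℚ ∘ edge-weight)) (listSum edge-weight (Γ G x)) 1ℚ
                (seq-∑-fromℚ edge-weight (Γ G x)) (vertex-weight≤1 x))) ,
      ≃-const (∑ (edges G) (fromℚ ∘ edge-weight)) (+ n / 2)
        (λ m → trans (seq-∑-fromℚ edge-weight (edges G) m) total-weight)

-- From a Hall violator to a large Rayleigh quotient for the complement.

module ComplementCliques where
  open import Data.Bool using (Bool; true; false; not; _∧_; if_then_else_; T?)
  open import Data.Bool.Properties using (if-float)
  open import Data.Fin using (Fin; zero; suc; _≟_)
  open import Data.Fin.Subset
  open import Data.Fin.Subset.Properties
  import Data.List as List
  open import Data.Nat using (ℕ; zero; suc; z≤n; s≤s)
  import Data.Nat as ℕ
  import Data.Nat.Properties as ℕ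
  open import Data.Product using (∃-syntax; _×_; _,_; proj₁; proj₂)
  open import Data.Rational using (ℚ; 0ℚ; 1ℚ; _*_; _+_)
  import Data.Rational as ℚ
  import Data.Rational.Properties as ℚ
  open import Data.Vec using (Vec; []; _∷_; lookup; tabulate)
  open import Data.Vec.Properties using (lookup∘tabulate; []=⇒lookup; lookup⇒[]=; lookup-zipWith)
  open import Function using (_∘_; id)
  open import Relation.Binary.PropositionalEquality
  open import Relation.Nullary using (yes; no; does; contradiction)
  open import Relation.Nullary.Decidable using (isYes≗does)
  import Defs
  open import Defs using (Graph; adj; adj-sym; complement; degree; signlessLaplacian; fromℕ; seq)
  open RationalLemmas
  open QuadraticForms
  open HallsTheorem
  open Bisection using (Lower)

  neighbourhood : ∀ {n} → Graph n → Fin n → Subset n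
  neighbourhood G v = tabulate (adj G v)

  ∈-neighbourhood⁺ : ∀ {n} (G : Graph n) {u v} → adj G u v ≡ true → v ∈ neighbourhood G u
  ∈-neighbourhood⁺ G {u} {v} u~v = lookup⇒[]= v _ (trans (lookup∘tabulate (adj G u) v) u~v)

  ∈-neighbourhood⁻ : ∀ {n} (G : Graph n) {u v} → v ∈ neighbourhood G u → adj G u v ≡ true
  ∈-neighbourhood⁻ G {u} {v} v∈ = trans (sym (lookup∘tabulate (adj G u) v)) ([]=⇒lookup v∈)

  neighbourhood-sym : ∀ {n} (G : Graph n) {u v} → v ∈ neighbourhood G u → u ∈ neighbourhood G v
  neighbourhood-sym G {u} {v} v∈ = ∈-neighbourhood⁺ G (trans (adj-sym G v u) (∈-neighbourhood⁻ G v∈))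

  length-filter-tabulate : ∀ {n} {A : Set} (f : A → Bool) (g : Fin n → A) →
    List.length (List.filter (λ x → T? (f x)) (List.tabulate g)) ≡ ∣ tabulate (f ∘ g) ∣
  length-filter-tabulate {zero}  f g = refl
  length-filter-tabulate {suc n} f g with f (g zero)
  ... | true  = cong suc (length-filter-tabulate f (g ∘ suc))
  ... | false = length-filter-tabulate f (g ∘ suc)

  degree≡∣neighbourhood∣ : ∀ {n} (G : Graph n) v → degree G v ≡ ∣ neighbourhood G v ∣
  degree≡∣neighbourhood∣ G v = length-filter-tabulate (adj G v) id

  LargeIndependentSet : ∀ {n} → Graph n → ℕ → Set
  LargeIndependentSet G k = ∃[ I ] (k ℕ.< ∣ I ∣ × (∀ {u v} → u ∈ I → v ∈ I → adj G u v ≡ false))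

  -- X ∖ N(X) is independent, and N(X ∖ N(X)) avoids X.
  violator⇒independent : ∀ {n} (G : Graph n) δ → (∀ v → δ ℕ.≤ degree G v) → Violator (neighbourhood G) →
    LargeIndependentSet G δ
  violator⇒independent {n} G δ δ≤ (X , ∣NX∣<∣X∣) = I , ℕ.≤-<-trans δ≤∣NI∣ ∣NI∣<∣I∣ , independent
    where
    R = neighbourhood G
    NX = neighbours R X
    I = X ∩ ∁ NX
    NI = neighbours R I

    ∈I⁻ : ∀ {u} → u ∈ I → u ∈ X × u ∉ NX
    ∈I⁻ u∈I = let u∈X , u∈∁ = x∈p∩q⁻ X (∁ NX) u∈I in u∈X , x∈∁p⇒x∉p u∈∁

    independent : ∀ {u v} → u ∈ I → v ∈ I → adj G u v ≡ false
    independent {u} {v} u∈I v∈I with adj G u v in eq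
    ... | false = refl
    ... | true  = contradiction (∈-neighbours⁺ R (proj₁ (∈I⁻ u∈I)) (∈-neighbourhood⁺ G eq)) (proj₂ (∈I⁻ v∈I))

    NI⊆ : NI ⊆ NX ∩ ∁ X
    NI⊆ {w} w∈ =
      let u , u∈I , w∈Ru = ∈-neighbours⁻ R {I} w∈
          u∈X , u∉NX     = ∈I⁻ u∈I
      in x∈p∩q⁺ (∈-neighbours⁺ R u∈X w∈Ru ,
                 x∉p⇒x∈∁p (λ w∈X → u∉NX (∈-neighbours⁺ R w∈X (neighbourhood-sym G w∈Ru))))

    -- Splitting both sides of |NX| < |X| along the common part X ∩ NX and cancelling it compares
    -- the part of NX outside X with `I`.
    ∣NI∣<∣I∣ : ∣ NI ∣ ℕ.< ∣ I ∣
    ∣NI∣<∣I∣ = ℕ.≤-<-trans (p⊆q⇒∣p∣≤∣q∣ NI⊆) (ℕ.+-cancelˡ-< ∣ X ∩ NX ∣ _ _ (begin-strict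
      ∣ X ∩ NX ∣ ℕ.+ ∣ NX ∩ ∁ X ∣   ≡⟨ cong (λ p → ∣ p ∣ ℕ.+ ∣ NX ∩ ∁ X ∣) (∩-comm X NX) ⟩
      ∣ NX ∩ X ∣ ℕ.+ ∣ NX ∩ ∁ X ∣   ≡⟨ sym (∣p∣≡∣p∩q∣+∣p∩∁q∣ NX X) ⟩
      ∣ NX ∣                        <⟨ ∣NX∣<∣X∣ ⟩
      ∣ X ∣                         ≡⟨ ∣p∣≡∣p∩q∣+∣p∩∁q∣ X NX ⟩
      ∣ X ∩ NX ∣ ℕ.+ ∣ I ∣          ∎))
      where open ℕ.≤-Reasoning

    -- The strict inequality above makes `I` nonempty, and `NI` contains the whole neighbourhood of
    -- any vertex of `I`.
    δ≤∣NI∣ : δ ℕ.≤ ∣ NI ∣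
    δ≤∣NI∣ = let u , u∈I = 0<∣p∣⇒Nonempty I (ℕ.≤-<-trans z≤n ∣NI∣<∣I∣) in
      ℕ.≤-trans (δ≤ u) (ℕ.≤-trans (ℕ.≤-reflexive (degree≡∣neighbourhood∣ G u))
        (p⊆q⇒∣p∣≤∣q∣ (∈-neighbours⁺ R u∈I)))

  𝟙 : Bool → ℚ
  𝟙 b = if b then 1ℚ else 0ℚ

  𝟙-∧ : ∀ a b → 𝟙 a * 𝟙 b ≡ 𝟙 (a ∧ b)
  𝟙-∧ true  b = ℚ.*-identityˡ (𝟙 b)
  𝟙-∧ false b = ℚ.*-zeroˡ (𝟙 b)

  sum-𝟙 : ∀ {n} (p : Subset n) → sum (λ i → 𝟙 (lookup p i)) ≡ ι ∣ p ∣
  sum-𝟙 []          = refl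
  sum-𝟙 (true ∷ p)  = trans (cong (_+_ 1ℚ) (sum-𝟙 p)) (sym (ι-suc ∣ p ∣))
  sum-𝟙 (false ∷ p) = trans (ℚ.+-identityˡ _) (sum-𝟙 p)

  module _ {n} (H : Graph n) where

    -- The entries of `signlessLaplacian` are constant sequences; these are their values.
    laplacian : Fin n → Fin n → ℚ
    laplacian i j = ι (degree H i) * δ i j + 𝟙 (adj H i j)

    laplacian-sym : Symmetric laplacian
    laplacian-sym i j = cong₂ _+_ (diagonal i j) (cong 𝟙 (adj-sym H i j))
      where
      diagonal : ∀ i j → ι (degree H i) * δ i j ≡ ι (degree H j) * δ j i
      diagonal i j with i ≟ j
      ... | yes refl = cong (ι (degree H i) *_) (sym (δ-refl i))
      ... | no i≢j   = trans (ℚ.*-zeroʳ (ι (degree H i)))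
        (sym (trans (cong (ι (degree H j) *_) (δ-≢ (i≢j ∘ sym))) (ℚ.*-zeroʳ (ι (degree H j)))))

    seq-signlessLaplacian : ∀ i j m → seq (signlessLaplacian H i j) m ≡ laplacian i j
    seq-signlessLaplacian i j m = cong₂ _+_
      (trans (cong (λ b → seq (if b then fromℕ (degree H i) else Defs.0ℝ) m) (isYes≗does (i ≟ j))) (diagonal (does (i ≟ j))))
      (if-float (λ x → seq x m) (adj H i j))
      where
      diagonal : ∀ b → seq (if b then fromℕ (degree H i) else Defs.0ℝ) m ≡ ι (degree H i) * (if b then 1ℚ else 0ℚ)
      diagonal true  = sym (ℚ.*-identityʳ _)
      diagonal false = sym (ℚ.*-zeroʳ (ι (degree H i)))

    -- The witness is the indicator vector of `I`. Its image at i ∈ I is the degree of i plus the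
    -- number of neighbours of i in `I`, each at least |I| - 1 ≥ k; indices outside `I` contribute 0
    -- to both sides.
    clique⇒lower : ∀ I k → k ℕ.< ∣ I ∣ → (∀ {u v} → u ∈ I → v ∈ I → u ≢ v → adj H u v ≡ true) →
                   Lower laplacian (ι (2 ℕ.* k))
    clique⇒lower I k k<∣I∣ clique = w ,
      (let i , i∈I = 0<∣p∣⇒Nonempty I (ℕ.≤-<-trans z≤n k<∣I∣) in
       norm²-pos w i (subst (0ℚ ℚ.<_) (cong (λ b → 𝟙 b * 𝟙 b) (sym ([]=⇒lookup i∈I))) (ℚ.positive⁻¹ 1ℚ))) ,
      subst (ℚ._≤ form laplacian w) (dot-scaleʳ (ι (2 ℕ.* k)) w w) (sum-mono (λ i → row i (lookup I i) refl))
      where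
      w : Fin n → ℚ
      w i = 𝟙 (lookup I i)

      dot-row : ∀ i → dot (laplacian i) w ≡ ι (degree H i) * w i + ι ∣ neighbourhood H i ∩ I ∣
      dot-row i = trans (dot-+ˡ (λ j → ι (degree H i) * δ i j) (λ j → 𝟙 (adj H i j)) w) (cong₂ _+_
        (trans (dot-scaleˡ (ι (degree H i)) (δ i) w) (cong (ι (degree H i) *_) (dot-δˡ i w)))
        (trans (sum-cong-≗ (λ j → trans (𝟙-∧ (adj H i j) (lookup I j)) (cong 𝟙 (sym
                 (trans (lookup-zipWith _∧_ j (neighbourhood H i) I) (cong (_∧ lookup I j) (lookup∘tabulate (adj H i) j)))))))
               (sum-𝟙 (neighbourhood H i ∩ I))))

      k≤ : ∀ {i} → i ∈ I → k ℕ.≤ ∣ neighbourhood H i ∩ I ∣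
      -- The strictness of k < |I| pays for `i`, which is not its own neighbour.
      k≤ {i} i∈I = ℕ.≤-pred (ℕ.≤-trans k<∣I∣ (ℕ.≤-trans (∣p∣≤1+∣p-x∣ I i) (s≤s (p⊆q⇒∣p∣≤∣q∣ λ j∈ →
        let j∈I , j∈∁i = x∈p∩q⁻ I (∁ ⁅ i ⁆) j∈ in
        x∈p∩q⁺ (∈-neighbourhood⁺ H (clique i∈I j∈I (λ i≡j → x∉⁅y⁆⇒x≢y (x∈∁p⇒x∉p j∈∁i) (sym i≡j))) , j∈I)))))

      k≤degree : ∀ {i} → i ∈ I → k ℕ.≤ degree H i
      k≤degree {i} i∈I = ℕ.≤-trans (k≤ i∈I) (ℕ.≤-trans (∣p∩q∣≤∣p∣ (neighbourhood H i) I)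
        (ℕ.≤-reflexive (sym (degree≡∣neighbourhood∣ H i))))

      row : ∀ i b → lookup I i ≡ b → w i * (ι (2 ℕ.* k) * w i) ℚ.≤ w i * dot (laplacian i) w
      row i false i∉ = ℚ.≤-reflexive (trans (cong (λ b → 𝟙 b * (ι (2 ℕ.* k) * w i)) i∉)
        (trans (ℚ.*-zeroˡ (ι (2 ℕ.* k) * w i)) (sym (trans (cong (λ b → 𝟙 b * dot (laplacian i) w) i∉)
          (ℚ.*-zeroˡ (dot (laplacian i) w))))))
      row i true i∈ = begin
        w i * (ι (2 ℕ.* k) * w i)                               ≡⟨ cong (λ z → z * (ι (2 ℕ.* k) * z)) wᵢ≡1 ⟩
        1ℚ * (ι (2 ℕ.* k) * 1ℚ)                                 ≡⟨ cong (1ℚ *_) (ℚ.*-identityʳ (ι (2 ℕ.* k))) ⟩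
        1ℚ * ι (2 ℕ.* k)                                        ≡⟨ cong (λ l → 1ℚ * ι (k ℕ.+ l)) (ℕ.+-identityʳ k) ⟩
        1ℚ * ι (k ℕ.+ k)                                        ≤⟨ ℚ.*-monoˡ-≤-nonNeg 1ℚ (ι-mono (ℕ.+-mono-≤ (k≤degree i∈I) (k≤ i∈I))) ⟩
        1ℚ * ι (degree H i ℕ.+ ∣ neighbourhood H i ∩ I ∣)       ≡⟨ cong (1ℚ *_) (ι-+ (degree H i) ∣ neighbourhood H i ∩ I ∣) ⟩
        1ℚ * (ι (degree H i) + ι ∣ neighbourhood H i ∩ I ∣)     ≡⟨ cong (λ z → 1ℚ * (z + ι ∣ neighbourhood H i ∩ I ∣)) (sym (ℚ.*-identityʳ (ι (degree H i)))) ⟩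
        1ℚ * (ι (degree H i) * 1ℚ + ι ∣ neighbourhood H i ∩ I ∣) ≡⟨ cong (λ z → z * (ι (degree H i) * z + ι ∣ neighbourhood H i ∩ I ∣)) (sym wᵢ≡1) ⟩
        w i * (ι (degree H i) * w i + ι ∣ neighbourhood H i ∩ I ∣) ≡⟨ cong (w i *_) (sym (dot-row i)) ⟩
        w i * dot (laplacian i) w                               ∎
        where
        open ℚ.≤-Reasoning
        i∈I = lookup⇒[]= i I i∈
        wᵢ≡1 = cong 𝟙 i∈

  complement-adj : ∀ {n} (G : Graph n) {u v} → u ≢ v → adj G u v ≡ false → adj (complement G) u v ≡ true
  complement-adj G {u} {v} u≢v u≁v with u ≟ v
  ... | yes u≡v = contradiction u≡v u≢v
  ... | no _    = cong not u≁v

-- Hall's alternative for the neighbourhoods of `G`.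

open import Defs
open import Data.Nat using (ℕ)
import Data.Nat as ℕ
open import Data.Bool.Properties using (T-≡)
open import Data.Empty using (⊥-elim)
open import Data.Fin.Subset using (_∈_; ∣_∣)
open import Data.Bool using (true)
open import Relation.Binary.PropositionalEquality using (_≡_; _≢_)
open import Data.Product using (_,_)
open import Data.Sum using ([_,_]′)
open import Function using (Equivalence)
open import Relation.Nullary using (¬_)
open ComplementCliques
open LargestEigenvalue using (lower⇒≮)
open FractionalMatchings using (perfectMatching)
open HallsTheorem using (hall)
open RationalLemmas using (ι)

Isq₁-clique : ∀ {n} (H : Graph n) I k → k ℕ.< ∣ I ∣ → (∀ {u v} → u ∈ I → v ∈ I → u ≢ v → adj H u v ≡ true) →
              ∀ q → Isq₁ H q → ¬ (q < fromℕ (2 ℕ.* k))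
Isq₁-clique H I k k<∣I∣ clique q q₁ = lower⇒≮ (signlessLaplacian H) (laplacian H) (laplacian-sym H)
  (seq-signlessLaplacian H) {ι (2 ℕ.* k)} (clique⇒lower H I k k<∣I∣ clique) q q₁

theorem4p2 : ∀ (n : ℕ) (G : Graph n) (δ : ℕ) (q : ℝ) → Connected G → IsMinDegree G δ → Isq₁ (complement G) q → q < fromℕ (2 ℕ.* δ) → HasFractionalPerfectMatching G
theorem4p2 n G δ q _ (_ , δ≤degree) q₁ q<2δ =
  [ (λ (σ , σ∈ , σ-inj) → perfectMatching G σ (λ u → Equivalence.from T-≡ (∈-neighbourhood⁻ G (σ∈ u))) σ-inj)
  , (λ violator → ⊥-elim (¬independent (violator⇒independent G δ δ≤degree violator)))
  ]′ (hall (neighbourhood G))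
  where
  ¬independent : ¬ LargeIndependentSet G δ
  ¬independent (I , δ<∣I∣ , independent) = Isq₁-clique (complement G) I δ δ<∣I∣
    (λ {u} {v} u∈I v∈I u≢v → complement-adj G {u} {v} u≢v (independent u∈I v∈I)) q q₁ q<2δ
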